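{- Let $G$ be a finite planar graph with no two intersecting triangles and such that every triangle of $G$ is adjacent to at most one $4$-cycle. Then $\mathrm{mad}(G)<4$.
   Context: A triangle is a $3$-cycle. Two cycles of a graph are adjacent if they share a common edge, and intersecting if they have at least one common vertex. The maximum average degree is $\mathrm{mad}(G)=\max\{2|E(H)|/|V(H)| : H \text{ a subgraph of } G\}$. -}

module Defs where

open import Data.Bool using (Bool; T; T?)
open import Data.Fin using (Fin; toℕ; _<?_)
open import Data.Fin.Properties using (all?)
open import Data.Fin.Subset using (Subset; inside; outside; _∈_; ∣_∣)
open import Data.Fin.Subset.Properties using (_∈?_)
open import Data.Integer using (+_)
open import Data.List as List using (List; []; _∷_; allFin; cartesianProduct; cartesianProductWith; filter; length; map)
import Data.List.Extrema as Extrema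
open import Data.Nat as ℕ using (ℕ; zero; suc; _+_; _*_)
open import Data.Nat.DivMod using (_mod_)
open import Data.Product using (Σ-syntax; ∃-syntax; _×_; _,_; proj₁; proj₂)
open import Data.Rational using (ℚ; 0ℚ; _/_)
import Data.Rational.Properties as ℚₚ
open import Data.Sum using (_⊎_)
import Data.Vec as Vec
open import Function.Bundles using (_↔_; _⇔_; module Inverse)
open import Function.Definitions using (Injective; Surjective)
open import Level using (0ℓ)
open import Relation.Binary.Bundles using (DecTotalOrder)
open import Relation.Binary.Construct.Closure.Equivalence using (EqClosure)
open import Relation.Binary.Core using (Rel)
open import Relation.Binary.Definitions using (Symmetric; Irreflexive)
open import Relation.Binary.PropositionalEquality using (_≡_)
open import Relation.Nullary using (¬_; Dec)
open import Relation.Nullary.Decidable using (_×-dec_; _→-dec_)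

-- Boolean-valued adjacency makes `Adj u v` a decidable proposition, so that
-- there is at most one edge between two vertices.
record Graph (n : ℕ) : Set where
  field
    adj : Fin n → Fin n → Bool

  Adj : Rel (Fin n) 0ℓ
  Adj u v = T (adj u v)

  field
    symmetric   : Symmetric Adj
    irreflexive : Irreflexive _≡_ Adj

  -- Each edge is listed once, with its smaller endpoint first.
  edges : List (Fin n × Fin n)
  edges = filter (λ (u , v) → (u <? v) ×-dec T? (adj u v))
                 (cartesianProduct (allFin n) (allFin n))

next : ∀ {k} → Fin k → Fin k
next {suc k} i = suc (toℕ i) mod suc k

record Cycle {n} (G : Graph n) (k : ℕ) : Set where
  open Graph G
  field
    3≤k      : 3 ℕ.≤ k
    vertex   : Fin k → Fin n
    distinct : Injective _≡_ _≡_ vertex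
    closed   : ∀ i → Adj (vertex i) (vertex (next i))

  HasVertex : Fin n → Set
  HasVertex v = ∃[ i ] vertex i ≡ v

  HasEdge : Fin n → Fin n → Set
  HasEdge u v = ∃[ i ] ((vertex i ≡ u × vertex (next i) ≡ v)
                      ⊎ (vertex i ≡ v × vertex (next i) ≡ u))

module _ {n} {G : Graph n} where
  open Cycle

  -- A `Cycle` carries a starting point and a direction; two of them are the
  -- same cycle of the graph when they have the same edges.
  SameCycle : ∀ {k l} → Cycle G k → Cycle G l → Set
  SameCycle C D = ∀ u v → HasEdge C u v ⇔ HasEdge D u v

  Adjacent : ∀ {k l} → Cycle G k → Cycle G l → Set
  Adjacent C D = ∃[ u ] ∃[ v ] (HasEdge C u v × HasEdge D u v)

  Intersecting : ∀ {k l} → Cycle G k → Cycle G l → Set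
  Intersecting C D = ∃[ v ] (HasVertex C v × HasVertex D v)

module _ {n} (G : Graph n) where

  Triangle : Set
  Triangle = Cycle G 3

  NoTwoIntersectingTriangles : Set
  NoTwoIntersectingTriangles =
    (T₁ T₂ : Triangle) → ¬ SameCycle T₁ T₂ → ¬ Intersecting T₁ T₂

  TrianglesAdjacentToAtMostOne4Cycle : Set
  TrianglesAdjacentToAtMostOne4Cycle =
    (T₀ : Triangle) (C D : Cycle G 4) →
    Adjacent T₀ C → Adjacent T₀ D → SameCycle C D

-- The quotient of A by the equivalence relation R has exactly k elements.
HasClasses : {A : Set} → Rel A 0ℓ → ℕ → Set
HasClasses {A} R k = Σ[ class ∈ (A → Fin k) ]
  Surjective _≡_ _≡_ class × (∀ x y → R x y ⇔ class x ≡ class y)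

SameOrbit : {A : Set} → (A → A) → Rel A 0ℓ
SameOrbit f = EqClosure (λ x y → f x ≡ y)

module _ {n} (G : Graph n) where
  open Graph G

  record Dart : Set where
    constructor dart
    field
      tail head : Fin n
      tail~head : Adj tail head

  open Dart

  reverse : Dart → Dart
  reverse (dart u v u~v) = dart v u (symmetric u~v)

  -- An embedding in an oriented surface, up to homeomorphism: the cyclic order
  -- in which the darts leaving each vertex appear around that vertex.
  record RotationSystem : Set where
    field
      rotation : Dart ↔ Dart

    rotate : Dart → Dart
    rotate = Inverse.to rotation

    field
      orbits-are-vertices : ∀ d e → SameOrbit rotate d e ⇔ tail d ≡ tail e

    -- The orbits of `faceStep` are the boundary walks of the faces.
    faceStep : Dart → Dart
    faceStep d = rotate (reverse d)

    SameComponent : Rel Dart 0ℓ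
    SameComponent = EqClosure (λ d e → rotate d ≡ e ⊎ reverse d ≡ e)

    -- Every component is embedded in a sphere: v − e + f = 2c.  As only darts
    -- are counted, an isolated vertex contributes to none of the four numbers.
    -- In an arbitrary rotation system each component contributes at most 2 to
    -- v − e + f, so equality of the sums forces equality in each component.
    Spherical : Set
    Spherical =
      ∃[ v ] ∃[ e ] ∃[ f ] ∃[ c ]
        ( HasClasses (SameOrbit rotate)   v
        × HasClasses (SameOrbit reverse)  e
        × HasClasses (SameOrbit faceStep) f
        × HasClasses SameComponent        c
        × v + f ≡ e + 2 * c )

  Planar : Set
  Planar = Σ[ R ∈ RotationSystem ] RotationSystem.Spherical R

subsets : ∀ n → List (Subset n)
subsets zero    = Vec.[] ∷ []
subsets (suc n) = cartesianProductWith Vec._∷_ (inside ∷ outside ∷ []) (subsets n)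

-- 2e / v, with the junk value 0 for the graph without vertices.
averageDegree : (v e : ℕ) → ℚ
averageDegree zero    e = 0ℚ
averageDegree (suc v) e = + (2 * e) / suc v

module _ {n} (G : Graph n) where
  open Graph G

  EdgeSubset : Set
  EdgeSubset = Subset (length edges)

  IsSubgraph : Subset n × EdgeSubset → Set
  IsSubgraph (S , F) = ∀ i → i ∈ F →
    proj₁ (List.lookup edges i) ∈ S × proj₂ (List.lookup edges i) ∈ S

  isSubgraph? : ∀ H → Dec (IsSubgraph H)
  isSubgraph? (S , F) = all? λ i → (i ∈? F) →-dec
    ((proj₁ (List.lookup edges i) ∈? S) ×-dec (proj₂ (List.lookup edges i) ∈? S))

  subgraphs : List (Subset n × EdgeSubset)
  subgraphs = filter isSubgraph? (cartesianProduct (subsets n) (subsets (length edges)))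

  open Extrema (DecTotalOrder.totalOrder ℚₚ.≤-decTotalOrder) using (max)

  -- Average degrees are nonnegative, so the default value 0 only matters for
  -- the graph without vertices.
  mad : ℚ
  mad = max 0ℚ (map (λ (S , F) → averageDegree ∣ S ∣ ∣ F ∣) subgraphs)

{-# OPTIONS --safe #-}
-- It suffices to show 2|E| < 4|V| for subgraphs induced by a nonempty vertex
-- set S.  A vertex of degree at most 2 in the subgraph can be deleted, so let
-- the minimum degree be at least 3.
--
-- Planarity passes to subgraphs as the inequality v + f ≥ e + 2c.  A dart d is
-- "detached" by composing the rotation σ with the transposition of d and σ⁻¹ d,
-- so that d becomes a vertex of its own.  This adds one vertex; the number of
-- faces changes by one, and if it drops then d and σ⁻¹ d stay connected, while
-- otherwise there is at most one new component.  After detaching all darts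
-- outside the subgraph, every unwanted edge is a component of its own.
--
-- Give every dart charge 2; the claim follows if every face ends up with at
-- least 8.  Each edge of a triangular face that lies on no 4-cycle takes 1 from
-- the dart on its other side.  At least two edges of a triangular face qualify,
-- since a 4-cycle through two of its edges would yield a second triangle.
-- Quadrangular faces give nothing.  In the other faces no two consecutive darts
-- give, for their common vertex would have degree 2; so a pentagon gives at
-- most 2 and a longer face keeps at least 3 for each two consecutive darts.
module Submission where

open import Defs
open import Data.Bool as Bool using (Bool; true; false; T?; _∧_; not)
open import Data.Bool.Properties using (T-irrelevant; ∧-comm; ∧-identityʳ)
open import Data.Empty using (⊥-elim)
open import Data.Fin as Fin using (Fin; zero; suc; toℕ; punchIn; punchOut; _≟_)
open import Data.Fin.Patterns using (0F; 1F; 2F; 3F)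
open import Data.Fin.Properties using (injective⇒≤; pigeonhole; punchInᵢ≢i; punchOut-cong; punchOut-punchIn; punchOut-injective; any?; toℕ<n; toℕ-injective)
open import Data.Fin.Permutation.Components using (transpose; transpose-inverse)
open import Data.Fin.Subset using (Subset; ∣_∣)
open import Data.Integer as ℤ using (+_; +<+)
import Data.Integer.Properties as ℤₚ
open import Data.List as List using (List; []; _∷_; allFin; cartesianProduct; filter)
import Data.List.Extrema as Extrema
open import Data.List.Membership.Propositional using (_∈_)
open import Data.List.Membership.Propositional.Properties using (∈-allFin; ∈-lookup; ∈-cartesianProduct⁺; ∈-filter⁺; ∈-filter⁻)
import Data.List.Relation.Unary.All as All
open import Data.List.Relation.Unary.All.Properties using (all-filter; map⁺)
open import Data.List.Relation.Unary.AllPairs using (_∷_)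
open import Data.List.Relation.Unary.Any using (here; there; index)
open import Data.List.Relation.Unary.Any.Properties using (lookup-index)
open import Data.List.Relation.Unary.Unique.Propositional using (Unique)
open import Data.List.Relation.Unary.Unique.Propositional.Properties using (allFin⁺; cartesianProduct⁺; filter⁺)
open import Data.Nat as ℕ using (ℕ; zero; suc; _+_; _*_; _∸_; _≤_; z≤n; s≤s)
open import Data.Nat.Properties hiding (_≟_)
open import Algebra.Properties.CommutativeMonoid.Sum +-0-commutativeMonoid using (sum; sum-cong-≗; ∑-comm; ∑-distrib-+)
open import Algebra.Properties.Semiring.Sum +-*-semiring using (*-distribˡ-sum)
open import Data.Nat.Tactic.RingSolver using (solve-∀)
open import Data.Product using (∃-syntax; _×_; _,_; proj₁; proj₂)
open import Data.Rational as ℚ using (_<_; _/_)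
import Data.Rational.Properties as ℚₚ
open import Data.Rational.Unnormalised using (mkℚᵘ; *<*)
import Data.Rational.Unnormalised.Properties as ℚᵘₚ
open import Data.Sum using (_⊎_; inj₁; inj₂; [_,_]; [_,_]′)
import Data.Vec as Vec
open import Data.Vec.Properties using (lookup⇒[]=; []=⇒lookup)
open import Function using (_∘_; id)
open import Function.Bundles using (_⇔_; mk⇔; module Equivalence; module Injection)
open import Function.Properties.Inverse using (↔⇒↣)
open import Function.Definitions using (Injective; Surjective)
open import Level using (0ℓ)
open import Relation.Binary.Bundles using (DecTotalOrder)
open import Relation.Binary.Construct.Closure.Equivalence as Eq using (EqClosure)
open import Relation.Binary.Construct.Closure.ReflexiveTransitive using (ε; _◅_; _◅◅_)
open import Relation.Binary.Construct.Closure.Symmetric using (SymClosure; fwd; bwd)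
import Relation.Binary.Construct.On as On
open import Relation.Binary.Core using (Rel; _⇒_)
open import Relation.Binary.Definitions using (Decidable; tri<; tri≈; tri>)
open import Relation.Binary.PropositionalEquality using (_≡_; _≢_; refl; sym; trans; cong; cong₂; subst; subst₂; isEquivalence; module ≡-Reasoning)
open import Relation.Binary.Structures using (IsEquivalence)
open import Relation.Nullary using (¬_; Dec; yes; no; does; contradiction)
open import Relation.Nullary.Decidable using (_×-dec_; _⊎-dec_; ¬?; dec-true; dec-false)
import Relation.Unary as Unary

-- Counting equivalence classes

variable
  A : Set
  R Q : Rel A 0ℓ
  k l : ℕ

module Classes {R : Rel A 0ℓ} (C : HasClasses R k) where
  private
    class = proj₁ C
    surj  = proj₁ (proj₂ C)
    iff   = proj₂ (proj₂ C)

  representative : Fin k → A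
  representative i = proj₁ (surj i)

  class-representative : ∀ i → class (representative i) ≡ i
  class-representative i = proj₂ (surj i) refl

  related⇒≡ : ∀ {x y} → R x y → class x ≡ class y
  related⇒≡ {x} {y} = Equivalence.to (iff x y)

  ≡⇒related : ∀ {x y} → class x ≡ class y → R x y
  ≡⇒related {x} {y} = Equivalence.from (iff x y)

  related? : Decidable R
  related? x y with class x ≟ class y
  ... | yes eq = yes (≡⇒related eq)
  ... | no neq = no (neq ∘ related⇒≡)

  representative-injective : ∀ {i j} → R (representative i) (representative j) → i ≡ j
  representative-injective {i} {j} r =
    trans (sym (class-representative i)) (trans (related⇒≡ r) (class-representative j))

-- Representatives of distinct `Q`-classes are not related by the finer `R`, so sending each to its
-- `R`-class is injective.
classes-antitone : R ⇒ Q → HasClasses R k → HasClasses Q l → l ≤ k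
classes-antitone R⇒Q C D = injective⇒≤ λ eq →
  representative-injective D (R⇒Q (≡⇒related C eq))
  where open Classes

classes-resp : R ⇒ Q → Q ⇒ R → HasClasses R k → HasClasses Q k
classes-resp R⇒Q Q⇒R (class , surj , iff) =
  class , surj , λ x y → mk⇔ (Equivalence.to (iff x y) ∘ Q⇒R) (R⇒Q ∘ Equivalence.from (iff x y))

module _ {i j : Fin (suc k)} (j≢i : j ≢ i) where

  -- The quotient map gluing `j` to `i`: the value `j` is removed from the range and takes the image
  -- of `i`.
  collapse : Fin (suc k) → Fin k
  collapse x with j ≟ x
  ... | yes _  = punchOut j≢i
  ... | no j≢x = punchOut j≢x

  collapse-≡ : collapse i ≡ collapse j
  collapse-≡ with j ≟ i | j ≟ j
  ... | yes j≡i | _     = contradiction j≡i j≢i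
  ... | no j≢i′ | yes _ = punchOut-cong j refl
  ... | no _    | no j≢j = contradiction refl j≢j

  collapse-punchIn : ∀ y → collapse (punchIn j y) ≡ y
  collapse-punchIn y with j ≟ punchIn j y
  ... | yes eq = contradiction (sym eq) (punchInᵢ≢i j y)
  ... | no j≢  = trans (punchOut-cong j refl) (punchOut-punchIn j)

  collapse-kernel : ∀ x y → collapse x ≡ collapse y → x ≡ y ⊎ (x ≡ i × y ≡ j) ⊎ (x ≡ j × y ≡ i)
  collapse-kernel x y eq with j ≟ x | j ≟ y
  ... | yes j≡x | yes j≡y = inj₁ (trans (sym j≡x) j≡y)
  ... | yes j≡x | no j≢y  = inj₂ (inj₂ (sym j≡x , sym (punchOut-injective j≢i j≢y eq)))
  ... | no j≢x  | yes j≡y = inj₂ (inj₁ (punchOut-injective j≢x j≢i eq , sym j≡y))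
  ... | no j≢x  | no j≢y  = inj₁ (punchOut-injective j≢x j≢y eq)

Join : Rel A 0ℓ → A → A → Rel A 0ℓ
Join R a b = EqClosure (λ x y → R x y ⊎ (x ≡ a × y ≡ b))

module _ {R : Rel A 0ℓ} {a b : A} where

  inner : R ⇒ Join R a b
  inner r = Eq.return (inj₁ r)

  joined : Join R a b a b
  joined = Eq.return (inj₂ (refl , refl))

  join-least : IsEquivalence Q → R ⇒ Q → Q a b → Join R a b ⇒ Q
  join-least {Q = Q} eq R⇒Q Qab = Eq.fold eq λ where
    (inj₁ r)             → R⇒Q r
    (inj₂ (refl , refl)) → Qab

  join-classes : HasClasses R (suc k) → ¬ R a b → HasClasses (Join R a b) k
  join-classes {k = k} C@(class , surj , iff) ¬Rab = class′ , surj′ , iff′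
    where
    open Classes C

    b≢a : class b ≢ class a
    b≢a eq = ¬Rab (≡⇒related (sym eq))

    class′ : A → Fin k
    class′ x = collapse b≢a (class x)

    surj′ : Surjective _≡_ _≡_ class′
    surj′ y = representative (punchIn (class b) y) , λ where
      refl → trans (cong (collapse b≢a) (class-representative _)) (collapse-punchIn b≢a y)

    related : ∀ x y → class′ x ≡ class′ y → Join R a b x y
    related x y eq with collapse-kernel b≢a (class x) (class y) eq
    ... | inj₁ x≡y               = inner (≡⇒related x≡y)
    ... | inj₂ (inj₁ (x≡a , y≡b)) =
      inner (≡⇒related x≡a) ◅◅ joined ◅◅ inner (≡⇒related (sym y≡b))
    ... | inj₂ (inj₂ (x≡b , y≡a)) =
      inner (≡⇒related x≡b) ◅◅ Eq.symmetric _ joined ◅◅ inner (≡⇒related (sym y≡a))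

    iff′ : ∀ x y → Join R a b x y ⇔ class′ x ≡ class′ y
    iff′ x y = mk⇔
      (join-least (On.isEquivalence class′ isEquivalence)
        (cong (collapse b≢a) ∘ related⇒≡) (collapse-≡ b≢a))
      (related x y)

  -- One new pair merges at most two classes. A class count makes `R` decidable, so it can be tested
  -- whether `a` and `b` are related already.
  join-classes-≤ : HasClasses R k → ∃[ l ] HasClasses (Join R a b) l × k ≤ suc l
  join-classes-≤ {k = zero} (class , _) = contradiction (class a) λ ()
  join-classes-≤ {k = suc k} C with Classes.related? C a b
  ... | no ¬Rab = k , join-classes C ¬Rab , ≤-refl
  ... | yes Rab = suc k , classes-resp inner (join-least Req id Rab) C , n≤1+n _
    where
    open Classes C
    Req : IsEquivalence R
    Req = record
      { refl  = ≡⇒related refl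
      ; sym   = ≡⇒related ∘ sym ∘ related⇒≡
      ; trans = λ p q → ≡⇒related (trans (related⇒≡ p) (related⇒≡ q)) }

private
  -- The pairs are joined one at a time, starting from equality with its `N` classes.
  list-classes : ∀ {N} (ps : List (Fin N × Fin N)) →
                 ∃[ k ] HasClasses (EqClosure (λ x y → (x , y) ∈ ps)) k
  list-classes {N} [] = N , id , (λ y → y , id) , λ x y →
    mk⇔ (Eq.fold isEquivalence (λ ())) (λ where refl → ε)
  list-classes ((a , b) ∷ ps) with list-classes ps
  ... | _ , C with join-classes-≤ {a = a} {b} C
  ... | l , D , _ = l , classes-resp
    (join-least (Eq.isEquivalence _) (Eq.map there) (Eq.return (here refl)))
    (Eq.fold (Eq.isEquivalence _) add)
    D
    where
    add : ∀ {x y} → (x , y) ∈ (a , b) ∷ ps → Join (EqClosure (λ x y → (x , y) ∈ ps)) a b x y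
    add (here refl) = joined
    add (there p)   = inner (Eq.return p)


-- Detaching creates new permutations whose orbits and components have to be counted afresh. A
-- decidable relation on `Fin N` is given by the finite list of its pairs.
closure-classes : ∀ {N} {R : Rel (Fin N) 0ℓ} → Decidable R → ∃[ k ] HasClasses (EqClosure R) k
closure-classes {N} {R} R? with list-classes (filter (λ (x , y) → R? x y) pairs)
  where pairs = cartesianProduct (allFin N) (allFin N)
... | k , C = k , classes-resp
  (Eq.map λ p → proj₂ (∈-filter⁻ (λ (x , y) → R? x y) {xs = cartesianProduct (allFin N) (allFin N)} p))
  (Eq.map λ r → ∈-filter⁺ (λ (x , y) → R? x y) (∈-cartesianProduct⁺ (∈-allFin _) (∈-allFin _)) r)
  C

-- Orbits of permutations of finite sets

iter : (A → A) → ℕ → A → A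
iter f zero    x = x
iter f (suc k) x = f (iter f k x)

iter-+ : ∀ (f : A → A) m n x → iter f (m + n) x ≡ iter f m (iter f n x)
iter-+ f zero    n x = refl
iter-+ f (suc m) n x = cong f (iter-+ f m n x)

iter-shift : ∀ (f : A → A) k x → iter f k (f x) ≡ iter f (suc k) x
iter-shift f k x = trans (sym (iter-+ f k 1 x)) (cong (λ m → iter f m x) (+-comm k 1))

iter-injective : ∀ {f : A → A} → Injective _≡_ _≡_ f → ∀ k {x y} → iter f k x ≡ iter f k y → x ≡ y
iter-injective inj zero    eq = eq
iter-injective inj (suc k) eq = iter-injective inj k (inj eq)

step : ∀ {f : A → A} {x} → SameOrbit f x (f x)
step = Eq.return refl

orbit-iter : ∀ {f : A → A} k {x} → SameOrbit f x (iter f k x)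
orbit-iter zero    = ε
orbit-iter (suc k) = orbit-iter k ◅◅ step

least : ∀ {P : ℕ → Set} → (∀ k → Dec (P k)) → ∀ k → P k → ∃[ m ] P m × (∀ j → j ℕ.< m → ¬ P j)
least P? zero p = zero , p , λ _ ()
least P? (suc k) p with P? zero
... | yes p₀ = zero , p₀ , λ _ ()
... | no ¬p₀ with least (P? ∘ suc) k p
... | m , pₘ , below = suc m , pₘ , λ where
  zero    _         → ¬p₀
  (suc j) (s≤s j<m) → below j j<m

module _ {N} {f : Fin N → Fin N} (f-inj : Injective _≡_ _≡_ f) where

  iter-cancel : ∀ {m n x} → m ℕ.< n → iter f m x ≡ iter f n x → iter f (n ∸ m) x ≡ x
  iter-cancel {m} {n} {x} m<n eq = iter-injective f-inj m (trans
    (sym (iter-+ f m (n ∸ m) x))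
    (trans (cong (λ l → iter f l x) (m+[n∸m]≡n (<⇒≤ m<n))) (sym eq)))

  -- Among `N + 1` iterates two coincide, and injectivity cancels their common part.
  returns : ∀ x → ∃[ k ] iter f (suc k) x ≡ x
  returns x with pigeonhole (n<1+n N) (λ i → iter f (toℕ i) x)
  ... | i , j , i<j , eq with toℕ j ∸ toℕ i | m<n⇒0<n∸m i<j | iter-cancel i<j eq
  ... | suc k | _ | eq′ = k , eq′

  preimage : ∀ x → ∃[ p ] f p ≡ x
  preimage x = let k , eq = returns x in iter f k x , eq

  -- A backward step from `f z` to `z` is replaced by the remaining forward steps around the cycle
  -- of `z`.
  forward : ∀ {x y} → SameOrbit f x y → ∃[ k ] iter f k x ≡ y
  forward ε = 0 , refl
  forward {x} (fwd refl ◅ r) with forward r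
  ... | k , eq = suc k , trans (sym (iter-shift f k x)) eq
  forward {x} (_◅_ {j = z} (bwd refl) r) with forward r | returns z
  ... | k , eq | j , ret = k + j , trans (iter-+ f k j (f z))
    (trans (cong (iter f k) (trans (iter-shift f j z) ret)) eq)

-- This is `g` equal to `f` after the transposition of `a` and `b`. The pointwise form is visibly
-- symmetric in `f` and `g`, and it can be checked directly for face permutations.
record Switched (f g : A → A) (a b : A) : Set where
  field
    at-a : g a ≡ f b
    at-b : g b ≡ f a
    off  : ∀ x → x ≢ a → x ≢ b → g x ≡ f x

  flipped : Switched g f a b
  flipped = record { at-a = sym at-b ; at-b = sym at-a ; off = λ x p q → sym (off x p q) }

module _ {N} {f g : Fin N → Fin N} {a b : Fin N} (s : Switched f g a b) where
  open Switched s

  -- At `a` and `b` the two maps have exchanged values, so an `f`-step from one of them is a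
  -- `g`-step from the other.
  switched-orbits : SameOrbit f ⇒ Join (SameOrbit g) a b
  switched-orbits = Eq.fold (Eq.isEquivalence _) (edge _)
    where
    edge : ∀ x {y} → f x ≡ y → Join (SameOrbit g) a b x y
    edge x refl with x ≟ a | x ≟ b
    ... | yes refl | _        = joined ◅◅ inner (Eq.return at-b)
    ... | no _     | yes refl = Eq.symmetric _ joined ◅◅ inner (Eq.return at-a)
    ... | no x≢a   | no x≢b   = inner (Eq.return (off x x≢a x≢b))

  -- Walking along f from f a = g b back to a avoids b, so g makes the same walk.
  switch-joins : Injective _≡_ _≡_ f → ¬ SameOrbit f a b → SameOrbit g a b
  switch-joins f-inj ¬fab with returns f-inj a
  ... | k , ret = Eq.symmetric _ ([ subst (SameOrbit g b) ret , id ]′ (walk k))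
    where
    walk : ∀ j → SameOrbit g b (iter f (suc j) a) ⊎ SameOrbit g b a
    walk zero = inj₁ (Eq.return at-b)
    walk (suc j) with walk j
    ... | inj₂ r = inj₂ r
    ... | inj₁ r with iter f (suc j) a ≟ a | iter f (suc j) a ≟ b
    ... | yes eq | _      = inj₂ (subst (SameOrbit g b) eq r)
    ... | no _   | yes eq = contradiction (subst (SameOrbit f a) eq (orbit-iter (suc j))) ¬fab
    ... | no ≢a  | no ≢b  = inj₁ (r ◅◅ Eq.return (off _ ≢a ≢b))

  -- The f-path from f a to its first arrival at b is closed under g and misses a.
  switch-splits : Injective _≡_ _≡_ f → Injective _≡_ _≡_ g → a ≢ b →
                  SameOrbit f a b → ¬ SameOrbit g a b
  switch-splits f-inj g-inj a≢b fab gab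
    with forward f-inj fab | forward g-inj (Eq.symmetric _ gab)
  ... | k₀ , eq₀ | k₁ , eq₁ with least (λ k → iter f k a ≟ b) k₀ eq₀
  ... | zero  , a≡b , _ = a≢b a≡b
  ... | suc m , hit , first = a∉Path (subst Path eq₁ (stays k₁))
    where
    Path : Fin N → Set
    Path x = ∃[ j ] j ≤ m × iter f (suc j) a ≡ x

    a∉Path : ¬ Path a
    a∉Path (j , j≤m , eq) = first (m ∸ j) (s≤s (m∸n≤m m j)) (trans
      (cong (iter f (m ∸ j)) (sym eq))
      (trans (sym (iter-+ f (m ∸ j) (suc j) a))
        (trans (cong (λ l → iter f l a) (trans (+-suc (m ∸ j) j) (cong suc (m∸n+n≡m j≤m)))) hit)))

    closed : ∀ {x} → Path x → Path (g x)
    closed {x} p@(j , j≤m , eq) with x ≟ b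
    ... | yes refl = 0 , z≤n , sym at-b
    ... | no x≢b = suc j , ≤∧≢⇒< j≤m (λ where refl → x≢b (trans (sym eq) hit)) ,
      trans (cong f eq) (sym (off x (λ where refl → a∉Path p) x≢b))

    stays : ∀ k → Path (iter g k b)
    stays zero    = m , ≤-refl , hit
    stays (suc k) = closed (stays k)

module _ {N} {f g : Fin N → Fin N} {a b : Fin N} (s : Switched f g a b)
         (C : HasClasses (SameOrbit f) k) (D : HasClasses (SameOrbit g) l) where
  open Switched s

  -- Joining `a` and `b` costs the orbits of `f` at most one class, and the result is coarser than
  -- the orbits of `g`.
  switch-classes-≤ : k ≤ suc l
  switch-classes-≤ with join-classes-≤ {a = a} {b} C
  ... | m , E , k≤1+m = ≤-trans k≤1+m (s≤s (classes-antitone (switched-orbits flipped) D E))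

  -- Joining `a` and `b` costs the orbits of `g` exactly one class, and the result still refines the
  -- orbits of `f`.
  switch-classes-suc : SameOrbit f a b → ¬ SameOrbit g a b → suc k ≤ l
  switch-classes-suc fab ¬gab = bound D
    where
    bound : ∀ {l} → HasClasses (SameOrbit g) l → suc k ≤ l
    bound {zero}  (class , _) = contradiction (class a) λ ()
    bound {suc l} D = s≤s (classes-antitone
      (join-least (Eq.isEquivalence _)
        (join-least (Eq.isEquivalence _) id fab ∘ switched-orbits flipped) fab)
      (join-classes D ¬gab) C)

fixed-orbit : ∀ {N} {f : Fin N → Fin N} → Injective _≡_ _≡_ f →
              ∀ {x y} → f x ≡ x → SameOrbit f x y → x ≡ y
fixed-orbit {f = f} f-inj {x} fix r with forward f-inj r
... | k , eq = trans (sym (iter-fixed k)) eq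
  where
  iter-fixed : ∀ k → iter f k x ≡ x
  iter-fixed zero    = refl
  iter-fixed (suc k) = trans (cong f (iter-fixed k)) fix

orbit-classes : ∀ {N} (f : Fin N → Fin N) → ∃[ k ] HasClasses (SameOrbit f) k
orbit-classes f = closure-classes (λ x y → f x ≟ y)

module _ {N} (f : Fin N → Fin N) (a b : Fin N) where

  switch : Fin N → Fin N
  switch = f ∘ transpose a b

  switch-injective : Injective _≡_ _≡_ f → Injective _≡_ _≡_ switch
  switch-injective f-inj eq = trans (sym (transpose-inverse b a))
    (trans (cong (transpose b a) (f-inj eq)) (transpose-inverse b a))

  switch-switched : Switched f switch a b
  switch-switched = record { at-a = cong f at-a ; at-b = cong f at-b ; off = λ x p q → cong f (off x p q) }
    where
    at-a : transpose a b a ≡ b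
    at-a with a ≟ a
    ... | yes _  = refl
    ... | no a≢a = contradiction refl a≢a

    at-b : transpose a b b ≡ a
    at-b with b ≟ a
    ... | yes b≡a = b≡a
    ... | no _ with b ≟ b
    ... | yes _  = refl
    ... | no b≢b = contradiction refl b≢b

    off : ∀ x → x ≢ a → x ≢ b → transpose a b x ≡ x
    off x x≢a x≢b with x ≟ a
    ... | yes x≡a = contradiction x≡a x≢a
    ... | no _ with x ≟ b
    ... | yes x≡b = contradiction x≡b x≢b
    ... | no _    = refl

-- Detaching darts from a map

module Detaching {N} (α : Fin N → Fin N) (α-involutive : ∀ x → α (α x) ≡ x) where

  Component : (Fin N → Fin N) → Rel (Fin N) 0ℓ
  Component σ = EqClosure (λ d e → σ d ≡ e ⊎ α d ≡ e)

  -- The half of Euler's formula that bounds `v + f` from below; each detachment preserves it. The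
  -- involution `α`, and with it `e`, never changes.
  EulerBound : (Fin N → Fin N) → Set
  EulerBound σ = ∃[ v ] ∃[ e ] ∃[ f ] ∃[ c ]
    ( HasClasses (SameOrbit σ) v
    × HasClasses (SameOrbit α) e
    × HasClasses (SameOrbit (σ ∘ α)) f
    × HasClasses (Component σ) c
    × e + 2 * c ≤ v + f )

  α-injective : Injective _≡_ _≡_ α
  α-injective {x} {y} eq = trans (sym (α-involutive x)) (trans (cong α eq) (α-involutive y))

  -- By `refines` no two vertices get merged; by `keeps` the darts that remain at a vertex are not
  -- torn apart when others leave it.
  record Detachment (σ : Fin N → Fin N) (X : Fin N → Set) : Set where
    field
      σ′        : Fin N → Fin N
      injective : Injective _≡_ _≡_ σ′
      bound     : EulerBound σ′
      fixed     : ∀ {x} → X x → σ′ x ≡ x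
      refines   : SameOrbit σ′ ⇒ SameOrbit σ
      keeps     : ∀ {x y} → ¬ X x → ¬ X y → SameOrbit σ x y → SameOrbit σ′ x y

  module _ {σ : Fin N → Fin N} (σ-inj : Injective _≡_ _≡_ σ) (euler : EulerBound σ) where

    module _ {d p : Fin N} (σd≢d : σ d ≢ d) (σp≡d : σ p ≡ d) where
      private
        σ′ = switch σ d p
        σ′-inj = switch-injective σ d p σ-inj
        sw = switch-switched σ d p
        open Switched sw

        d≢p : d ≢ p
        d≢p d≡p = σd≢d (trans (cong σ d≡p) σp≡d)

        fixed : σ′ d ≡ d
        fixed = trans at-a σp≡d

        d~p : SameOrbit σ d p
        d~p = Eq.symmetric _ (Eq.return σp≡d)

        -- Conjugation by the involution `α` carries the transposition of `d` and `p` to that of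
        -- `α d` and `α p`.
        faces-switched : Switched (σ ∘ α) (σ′ ∘ α) (α d) (α p)
        faces-switched = record
          { at-a = trans (cong σ′ (α-involutive d)) (trans at-a (cong σ (sym (α-involutive p))))
          ; at-b = trans (cong σ′ (α-involutive p)) (trans at-b (cong σ (sym (α-involutive d))))
          ; off  = λ x x≢αd x≢αp → off (α x) (x≢αd ∘ flip x) (x≢αp ∘ flip x) }
          where
          flip : ∀ x {y} → α x ≡ y → x ≡ α y
          flip x eq = trans (sym (α-involutive x)) (cong α eq)

        orbit⇒component : SameOrbit σ′ ⇒ Component σ′
        orbit⇒component = Eq.map inj₁

        components-join : Component σ ⇒ Join (Component σ′) d p
        components-join = Eq.fold (Eq.isEquivalence _) λ where
          (inj₁ eq) → join-least (Eq.isEquivalence _) (inner ∘ orbit⇒component) joined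
                        (switched-orbits sw (Eq.return eq))
          (inj₂ eq) → inner (Eq.return (inj₂ eq))

        face⇒component : SameOrbit (σ′ ∘ α) ⇒ Component σ′
        face⇒component = Eq.fold (Eq.isEquivalence _) λ eq →
          Eq.return (inj₂ refl) ◅◅ Eq.return (inj₁ eq)

        bound′ : EulerBound σ → EulerBound σ′
        bound′ (v , e , f , c , V , E , F , C , ineq)
          with orbit-classes σ′ | orbit-classes (σ′ ∘ α)
             | closure-classes (λ x y → (σ′ x ≟ y) ⊎-dec (α x ≟ y))
        ... | v′ , V′ | f′ , F′ | c′ , C′ =
          v′ , e , f′ , c′ , V′ , E , F′ , C′ , ineq′
          where
          open ≤-Reasoning

          v<v′ : suc v ≤ v′
          v<v′ = switch-classes-suc sw V V′ d~p (d≢p ∘ fixed-orbit σ′-inj fixed)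

          ineq′ : e + 2 * c′ ≤ v′ + f′
          ineq′ with Classes.related? F (α d) (α p)
          -- The face through `α d` and `α p` splits. The new face and the new vertex together pay
          -- the 2 owed for one possible new component.
          ... | yes same = begin
            e + 2 * c′      ≤⟨ +-monoʳ-≤ e (*-monoʳ-≤ 2 c′≤1+c) ⟩
            e + 2 * suc c   ≡⟨ cong (_+_ e) (*-suc 2 c) ⟩
            e + (2 + 2 * c) ≡⟨ +-comm e (2 + 2 * c) ⟩
            2 + (2 * c + e) ≡⟨ cong (_+_ 2) (+-comm (2 * c) e) ⟩
            2 + (e + 2 * c) ≤⟨ +-monoʳ-≤ 2 ineq ⟩
            2 + (v + f)     ≡⟨ cong suc (sym (+-suc v f)) ⟩
            suc v + suc f   ≤⟨ +-mono-≤ v<v′ f<f′ ⟩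
            v′ + f′         ∎
            where
            f<f′ : suc f ≤ f′
            f<f′ = switch-classes-suc faces-switched F F′ same
              (switch-splits faces-switched (α-injective ∘ σ-inj) (α-injective ∘ σ′-inj)
                (d≢p ∘ α-injective) same)

            c′≤1+c : c′ ≤ suc c
            c′≤1+c with join-classes-≤ {a = d} {p} C′
            ... | l , J , c′≤1+l = ≤-trans c′≤1+l (s≤s (classes-antitone components-join C J))
          -- Two faces merge. The new vertex only makes up for the lost face, so no new component
          -- can be afforded.
          ... | no differ = begin
            e + 2 * c′ ≤⟨ +-monoʳ-≤ e (*-monoʳ-≤ 2 c′≤c) ⟩
            e + 2 * c  ≤⟨ ineq ⟩
            v + f      ≤⟨ +-monoʳ-≤ v (switch-classes-≤ faces-switched F F′) ⟩
            v + suc f′ ≡⟨ +-suc v f′ ⟩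
            suc v + f′ ≤⟨ +-monoˡ-≤ f′ v<v′ ⟩
            v′ + f′    ∎
            where
            -- The merged face contains both `α d` and `α p`, and walking along it connects `d` to
            -- `p`.
            still : Component σ′ d p
            still = Eq.return (inj₂ refl)
              ◅◅ face⇒component (switch-joins faces-switched (α-injective ∘ σ-inj) differ)
              ◅◅ Eq.return (inj₂ (α-involutive p))

            c′≤c : c′ ≤ c
            c′≤c = classes-antitone
              (join-least (Eq.isEquivalence _) id still ∘ components-join) C C′

        -- Replacing `d` by its predecessor `p` turns a `σ`-path through `d` into a `σ′`-path around
        -- it.
        bypass : Fin N → Fin N
        bypass x with x ≟ d
        ... | yes _ = p
        ... | no  _ = x

        bypass-≢ : ∀ {x} → x ≢ d → bypass x ≡ x
        bypass-≢ {x} x≢d with x ≟ d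
        ... | yes x≡d = contradiction x≡d x≢d
        ... | no _    = refl

        bypass-step : ∀ {x y} → σ x ≡ y → SameOrbit σ′ (bypass x) (bypass y)
        bypass-step {x} refl with x ≟ d | σ x ≟ d
        ... | yes refl | yes σd≡d = contradiction σd≡d σd≢d
        ... | yes refl | no _     = Eq.return at-b
        ... | no x≢d   | yes σx≡d = subst (SameOrbit σ′ x) (σ-inj (trans σx≡d (sym σp≡d))) ε
        ... | no x≢d   | no σx≢d  = Eq.return (off x x≢d λ where refl → σx≢d σp≡d)

        keeps : ∀ {x y} → ¬ x ≡ d → ¬ y ≡ d → SameOrbit σ x y → SameOrbit σ′ x y
        keeps x≢d y≢d r = subst₂′ (bypass-≢ x≢d) (bypass-≢ y≢d)
          (Eq.gfold (Eq.isEquivalence _) bypass bypass-step r)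
          where
          subst₂′ : ∀ {x x′ y y′} → x ≡ x′ → y ≡ y′ → SameOrbit σ′ x y → SameOrbit σ′ x′ y′
          subst₂′ refl refl r = r

      detach-moved : Detachment σ (_≡ d)
      detach-moved = record
        { σ′        = σ′
        ; injective = σ′-inj
        ; bound     = bound′ euler
        ; fixed     = λ where refl → fixed
        ; refines   = join-least (Eq.isEquivalence _) id d~p ∘ switched-orbits flipped
        ; keeps     = keeps }

    detach : ∀ d → Detachment σ (_≡ d)
    detach d with σ d ≟ d
    ... | no σd≢d = detach-moved σd≢d (proj₂ (preimage σ-inj d))
    ... | yes σd≡d = record
      { σ′        = σ
      ; injective = σ-inj
      ; bound     = euler
      ; fixed     = λ where refl → σd≡d
      ; refines   = id
      ; keeps     = λ _ _ → id }

  open Detachment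

  detach-list : ∀ {σ} → Injective _≡_ _≡_ σ → EulerBound σ → ∀ ds → Detachment σ (_∈ ds)
  detach-list {σ} σ-inj euler [] = record
    { σ′        = σ
    ; injective = σ-inj
    ; bound     = euler
    ; fixed     = λ ()
    ; refines   = id
    ; keeps     = λ _ _ → id }
  detach-list σ-inj euler (d ∷ ds) = record
    { σ′        = σ′ second
    ; injective = injective second
    ; bound     = bound second
    ; fixed     = λ where
        -- After the first detachment `d` is alone in its orbit, and later detachments only refine
        -- orbits, so it stays fixed.
        (here refl) → sym (fixed-orbit (injective first) (fixed first refl) (refines second step))
        (there x∈)  → fixed second x∈
    ; refines   = refines first ∘ refines second
    ; keeps     = λ x∉ y∉ → keeps second (x∉ ∘ there) (y∉ ∘ there)
                          ∘ keeps first (x∉ ∘ here) (y∉ ∘ here) }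
    where
    first  = detach σ-inj euler d
    second = detach-list (injective first) (bound first) ds

  detach-all : ∀ {σ} → Injective _≡_ _≡_ σ → EulerBound σ →
               ∀ {X : Fin N → Set} → Unary.Decidable X → Detachment σ X
  detach-all σ-inj euler {X} X? = record
    { σ′        = σ′ D
    ; injective = injective D
    ; bound     = bound D
    ; fixed     = λ x∈X → fixed D (∈-filter⁺ X? (∈-allFin _) x∈X)
    ; refines   = refines D
    ; keeps     = λ x∉X y∉X → keeps D (x∉X ∘ listed) (y∉X ∘ listed) }
    where
    D = detach-list σ-inj euler (filter X? (allFin N))
    listed : ∀ {x} → x ∈ filter X? (allFin N) → X x
    listed = proj₂ ∘ ∈-filter⁻ X? {xs = allFin N}

-- Finite sums

⟦_⟧ : Bool → ℕ
⟦ true ⟧  = 1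
⟦ false ⟧ = 0

size : ∀ {N} → (Fin N → Bool) → ℕ
size b = sum (⟦_⟧ ∘ b)

guard : ∀ {P : Set} → Dec P → ℕ → ℕ
guard (yes _) m = m
guard (no _)  _ = 0

guard-yes : ∀ {P : Set} (P? : Dec P) {m} → P → guard P? m ≡ m
guard-yes (yes _) p = refl
guard-yes (no ¬p) p = contradiction p ¬p

guard-≤ : ∀ {P : Set} (P? : Dec P) m → guard P? m ≤ m
guard-≤ (yes _) m = ≤-refl
guard-≤ (no _)  m = z≤n

guard-support : ∀ {P : Set} (P? : Dec P) {m} → guard P? m ≢ 0 → P × m ≢ 0
guard-support (yes p) m≢0 = p , m≢0
guard-support (no _)  0≢0 = contradiction refl 0≢0

sum-mono : ∀ {N} {u w : Fin N → ℕ} → (∀ i → u i ≤ w i) → sum u ≤ sum w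
sum-mono {zero}  u≤w = z≤n
sum-mono {suc N} u≤w = +-mono-≤ (u≤w zero) (sum-mono (u≤w ∘ suc))

sum-zero : ∀ {N} {u : Fin N → ℕ} → (∀ i → u i ≡ 0) → sum u ≡ 0
sum-zero {zero}  u≡0 = refl
sum-zero {suc N} u≡0 = cong₂ _+_ (u≡0 zero) (sum-zero (u≡0 ∘ suc))

sum-const : ∀ N m → sum {N} (λ _ → m) ≡ N * m
sum-const zero    m = refl
sum-const (suc N) m = cong (_+_ m) (sum-const N m)

sum-point : ∀ {N} (a : Fin N) (u : Fin N → ℕ) → sum (λ i → guard (a ≟ i) (u i)) ≡ u a
sum-point zero    u = trans
  (cong (_+_ (u zero)) (sum-zero {u = λ i → guard (zero ≟ suc i) (u (suc i))} λ _ → refl))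
  (+-identityʳ _)
sum-point (suc a) u = trans (sum-cong-≗ λ i → guard-suc i) (sum-point a (u ∘ suc))
  where
  guard-suc : ∀ i → guard (suc a ≟ suc i) (u (suc i)) ≡ guard (a ≟ i) (u (suc i))
  guard-suc i with a ≟ i
  ... | yes _ = refl
  ... | no _  = refl

sum-single : ∀ {N} {u : Fin N → ℕ} {b} → (∀ i → u i ≤ b) →
             (∀ i j → u i ≢ 0 → u j ≢ 0 → i ≡ j) → sum u ≤ b
sum-single {zero} _ _ = z≤n
sum-single {suc N} {u} {b} u≤b unique with u zero ℕ.≟ 0
... | yes u₀≡0 rewrite u₀≡0 =
  sum-single (u≤b ∘ suc) λ i j p q → suc-inj (unique (suc i) (suc j) p q)
  where
  suc-inj : ∀ {i j : Fin N} → suc i ≡ suc j → i ≡ j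
  suc-inj refl = refl
... | no u₀≢0 = subst (_≤ b) (sym (trans (cong (_+_ (u zero)) (sum-zero rest)) (+-identityʳ _))) (u≤b zero)
  where
  rest : ∀ i → u (suc i) ≡ 0
  rest i with u (suc i) ℕ.≟ 0
  ... | yes eq = eq
  ... | no neq = contradiction (unique zero (suc i) u₀≢0 neq) λ ()

sum-pair : ∀ {N} {u : Fin N → ℕ} {a b} → (∀ i → u i ≢ 0 → i ≡ a ⊎ i ≡ b) → sum u ≤ u a + u b
sum-pair {N} {u} {a} {b} support = begin
  sum u                                                    ≤⟨ sum-mono covered ⟩
  sum (λ i → guard (a ≟ i) (u i) + guard (b ≟ i) (u i))    ≡⟨ ∑-distrib-+ {N} _ _ ⟩
  sum (λ i → guard (a ≟ i) (u i)) + sum (λ i → guard (b ≟ i) (u i))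
    ≡⟨ cong₂ _+_ (sum-point a u) (sum-point b u) ⟩
  u a + u b ∎
  where
  open ≤-Reasoning
  covered : ∀ i → u i ≤ guard (a ≟ i) (u i) + guard (b ≟ i) (u i)
  covered i with u i ℕ.≟ 0
  ... | yes eq = ≤-trans (≤-reflexive eq) z≤n
  ... | no neq with support i neq
  ... | inj₁ refl = ≤-trans (≤-reflexive (sym (guard-yes (a ≟ a) refl))) (m≤m+n _ _)
  ... | inj₂ refl = ≤-trans (≤-reflexive (sym (guard-yes (b ≟ b) refl))) (m≤n+m _ _)

module _ {M N} (g : Fin M → Fin N) where

  fibre : (Fin M → ℕ) → Fin N → ℕ
  fibre u j = sum (λ i → guard (g i ≟ j) (u i))

  sum-fibre : ∀ u → sum u ≡ sum (fibre u)
  sum-fibre u = trans (sum-cong-≗ λ i → sym (sum-point (g i) (λ _ → u i))) (∑-comm {M} {N} _)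

  -- Each fibre of `g` holds at most one nonzero term of `u`. Asking for injectivity on the support
  -- alone allows indicator functions to select the relevant indices.
  sum-injection : ∀ {u w} → (∀ i → u i ≤ w (g i)) →
                  (∀ i j → u i ≢ 0 → u j ≢ 0 → g i ≡ g j → i ≡ j) → sum u ≤ sum w
  sum-injection {u} {w} u≤w injective = ≤-trans (≤-reflexive (sum-fibre u)) (sum-mono bound)
    where
    bound : ∀ j → fibre u j ≤ w j
    bound j = sum-single below λ i i′ p q →
      let gi≡j , ui≢0 = guard-support (g i ≟ j) p
          gi′≡j , ui′≢0 = guard-support (g i′ ≟ j) q
      in injective i i′ ui≢0 ui′≢0 (trans gi≡j (sym gi′≡j))
      where
      below : ∀ i → guard (g i ≟ j) (u i) ≤ w j
      below i with g i ≟ j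
      ... | yes refl = u≤w i
      ... | no _     = z≤n

  fibres-≤ : ∀ {u b} → (∀ j → fibre u j ≤ b) → sum u ≤ N * b
  fibres-≤ {u} {b} bound = begin
    sum u         ≡⟨ sum-fibre u ⟩
    sum (fibre u) ≤⟨ sum-mono bound ⟩
    sum {N} (λ _ → b) ≡⟨ sum-const N b ⟩
    N * b         ∎
    where open ≤-Reasoning

  fibres-≥ : ∀ {u b} → (∀ j → b ≤ fibre u j) → N * b ≤ sum u
  fibres-≥ {u} {b} bound = begin
    N * b         ≡⟨ sym (sum-const N b) ⟩
    sum {N} (λ _ → b) ≤⟨ sum-mono bound ⟩
    sum (fibre u) ≡⟨ sym (sum-fibre u) ⟩
    sum u         ∎
    where open ≤-Reasoning

-- Triangles and 4-cycles

module ShortCycles {n} (G : Graph n) where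
  open Graph G

  adj⇒≢ : ∀ {u v} → Adj u v → u ≢ v
  adj⇒≢ u~v u≡v = irreflexive u≡v u~v

  adj⇒≢′ : ∀ {u v} → Adj u v → v ≢ u
  adj⇒≢′ u~v v≡u = irreflexive (sym v≡u) u~v

  triangle : ∀ {a b c} → Adj a b → Adj b c → Adj c a → Triangle G
  triangle {a} {b} {c} ab bc ca = record
    { 3≤k = ≤-refl ; vertex = vertex ; distinct = distinct _ _ ; closed = closed }
    where
    vertex : Fin 3 → Fin n
    vertex 0F = a
    vertex 1F = b
    vertex 2F = c

    distinct : ∀ i j → vertex i ≡ vertex j → i ≡ j
    distinct 0F 0F _  = refl
    distinct 0F 1F eq = contradiction eq (adj⇒≢ ab)
    distinct 0F 2F eq = contradiction eq (adj⇒≢′ ca)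
    distinct 1F 0F eq = contradiction eq (adj⇒≢′ ab)
    distinct 1F 1F _  = refl
    distinct 1F 2F eq = contradiction eq (adj⇒≢ bc)
    distinct 2F 0F eq = contradiction eq (adj⇒≢ ca)
    distinct 2F 1F eq = contradiction eq (adj⇒≢′ bc)
    distinct 2F 2F _  = refl

    closed : ∀ i → Adj (vertex i) (vertex (next i))
    closed 0F = ab
    closed 1F = bc
    closed 2F = ca

  -- The cycle is `u v p q`, with the edge `uv` supplied separately. Only opposite vertices need
  -- explicit inequalities; consecutive ones differ by irreflexivity.
  On4Cycle : Fin n → Fin n → Set
  On4Cycle u v = ∃[ p ] ∃[ q ] Adj v p × Adj p q × Adj q u × p ≢ u × q ≢ v

  on4Cycle? : Decidable On4Cycle
  on4Cycle? u v = any? λ p → any? λ q →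
    T? (adj v p) ×-dec T? (adj p q) ×-dec T? (adj q u) ×-dec ¬? (p ≟ u) ×-dec ¬? (q ≟ v)

  on4Cycle-sym : ∀ {u v} → On4Cycle u v → On4Cycle v u
  on4Cycle-sym (p , q , vp , pq , qu , p≢u , q≢v) =
    q , p , symmetric qu , symmetric pq , symmetric vp , q≢v , p≢u

  fourCycle : ∀ {u v} → Adj u v → On4Cycle u v → Cycle G 4
  fourCycle {u} {v} uv (p , q , vp , pq , qu , p≢u , q≢v) = record
    { 3≤k = n≤1+n 3 ; vertex = vertex ; distinct = distinct _ _ ; closed = closed }
    where
    vertex : Fin 4 → Fin n
    vertex 0F = u
    vertex 1F = v
    vertex 2F = p
    vertex 3F = q

    distinct : ∀ i j → vertex i ≡ vertex j → i ≡ j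
    distinct 0F 0F _  = refl
    distinct 0F 1F eq = contradiction eq (adj⇒≢ uv)
    distinct 0F 2F eq = contradiction (sym eq) p≢u
    distinct 0F 3F eq = contradiction eq (adj⇒≢′ qu)
    distinct 1F 0F eq = contradiction eq (adj⇒≢′ uv)
    distinct 1F 1F _  = refl
    distinct 1F 2F eq = contradiction eq (adj⇒≢ vp)
    distinct 1F 3F eq = contradiction (sym eq) q≢v
    distinct 2F 0F eq = contradiction eq p≢u
    distinct 2F 1F eq = contradiction eq (adj⇒≢′ vp)
    distinct 2F 2F _  = refl
    distinct 2F 3F eq = contradiction eq (adj⇒≢ pq)
    distinct 3F 0F eq = contradiction eq (adj⇒≢ qu)
    distinct 3F 1F eq = contradiction eq q≢v
    distinct 3F 2F eq = contradiction eq (adj⇒≢′ pq)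
    distinct 3F 3F _  = refl

    closed : ∀ i → Adj (vertex i) (vertex (next i))
    closed 0F = uv
    closed 1F = vp
    closed 2F = pq
    closed 3F = qu

  module _ (disjoint : NoTwoIntersectingTriangles G) where

    -- Both triangles pass through `a`, so they are the same cycle; otherwise the edge `ax` would
    -- lie on the second only.
    triangle-unique : ∀ {a b c x y} → Adj a b → Adj b c → Adj c a →
                      Adj a x → Adj x y → Adj y a → x ≡ b ⊎ x ≡ c
    triangle-unique {a} {b} {c} {x} ab bc ca ax xy ya with x ≟ b | x ≟ c
    ... | yes x≡b | _       = inj₁ x≡b
    ... | no _    | yes x≡c = inj₂ x≡c
    ... | no x≢b  | no x≢c  = ⊥-elim (disjoint T₁ T₂ different (a , (0F , refl) , (0F , refl)))
      where
      T₁ = triangle ab bc ca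
      T₂ = triangle ax xy ya

      no-edge : ¬ Cycle.HasEdge T₁ a x
      no-edge (0F , inj₁ (_ , b≡x)) = x≢b (sym b≡x)
      no-edge (0F , inj₂ (a≡x , _)) = adj⇒≢ ax a≡x
      no-edge (1F , inj₁ (b≡a , _)) = adj⇒≢′ ab b≡a
      no-edge (1F , inj₂ (b≡x , _)) = x≢b (sym b≡x)
      no-edge (2F , inj₁ (c≡a , _)) = adj⇒≢ ca c≡a
      no-edge (2F , inj₂ (c≡x , _)) = x≢c (sym c≡x)

      different : ¬ SameCycle T₁ T₂
      different same = no-edge (Equivalence.from (same a x) (0F , inj₁ (refl , refl)))

    -- The 4-cycle through ab must also pass through bc, and then its fourth
    -- vertex spans a second triangle with a and c.
    at-most-one-edge-on-4-cycle : TrianglesAdjacentToAtMostOne4Cycle G →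
      ∀ {a b c} → Adj a b → Adj b c → Adj c a → On4Cycle a b → ¬ On4Cycle b c
    at-most-one-edge-on-4-cycle single {a} {b} {c} ab bc ca
      C@(p , q , bp , pq , qa , p≢a , q≢b) D = excluded (Equivalence.from (same b c) (0F , inj₁ (refl , refl)))
      where
      same : SameCycle (fourCycle ab C) (fourCycle bc D)
      same = single (triangle ab bc ca) (fourCycle ab C) (fourCycle bc D)
        (a , b , (0F , inj₁ (refl , refl)) , (0F , inj₁ (refl , refl)))
        (b , c , (1F , inj₁ (refl , refl)) , (0F , inj₁ (refl , refl)))

      excluded : ¬ Cycle.HasEdge (fourCycle ab C) b c
      excluded (0F , inj₁ (a≡b , _)) = adj⇒≢ ab a≡b
      excluded (0F , inj₂ (a≡c , _)) = adj⇒≢′ ca a≡c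
      excluded (1F , inj₁ (_ , refl)) with triangle-unique ab bc ca (symmetric qa) (symmetric pq) ca
      ... | inj₁ q≡b = q≢b q≡b
      ... | inj₂ q≡c = adj⇒≢′ pq q≡c
      excluded (1F , inj₂ (b≡c , _)) = adj⇒≢ bc b≡c
      excluded (2F , inj₁ (p≡b , _)) = adj⇒≢′ bp p≡b
      excluded (2F , inj₂ (_ , q≡b)) = q≢b q≡b
      excluded (3F , inj₁ (q≡b , _)) = q≢b q≡b
      excluded (3F , inj₂ (_ , a≡b)) = adj⇒≢ ab a≡b

-- Discharging

-- Here `σ` stands for the rotation after the darts outside the subgraph have been detached. Orbits
-- of length 1 and 2 are those with `σ (σ d) ≡ d`, so `degree≥3` excludes both at once.
module Discharging
  {n} (G : Graph n)
  (disjoint : NoTwoIntersectingTriangles G)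
  (single : TrianglesAdjacentToAtMostOne4Cycle G)
  {N} (tail : Fin N → Fin n) (α : Fin N → Fin N) (α-involutive : ∀ d → α (α d) ≡ d)
  (adjacent : ∀ d → Graph.Adj G (tail d) (tail (α d)))
  (simple : ∀ {d e} → tail d ≡ tail e → tail (α d) ≡ tail (α e) → d ≡ e)
  (kept : Fin N → Bool) (kept-α : ∀ d → kept (α d) ≡ kept d)
  (σ : Fin N → Fin N) (σ-inj : Injective _≡_ _≡_ σ)
  (tail-σ : ∀ d → tail (σ d) ≡ tail d)
  (σ-fixed : ∀ {d} → kept d ≡ false → σ d ≡ d)
  (same-tail : ∀ {d e} → kept d ≡ true → kept e ≡ true → tail d ≡ tail e → SameOrbit σ d e)
  (degree≥3 : ∀ {d} → kept d ≡ true → σ (σ d) ≢ d)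
  where

  open Graph G
  open ShortCycles G
  open Detaching α α-involutive using (α-injective; Component; EulerBound)

  Kept : Fin N → Set
  Kept d = kept d ≡ true

  φ : Fin N → Fin N
  φ = σ ∘ α

  φ-inj : Injective _≡_ _≡_ φ
  φ-inj = α-injective ∘ σ-inj

  -- If a kept `d` were sent to a detached dart, which `σ` fixes, injectivity would make `d` itself
  -- a fixed point, of degree 1.
  kept-σ : ∀ d → kept (σ d) ≡ kept d
  kept-σ d with kept d in kd | kept (σ d) in kσd
  ... | true  | true  = refl
  ... | false | false = refl
  ... | true  | false = contradiction (trans (σ-fixed kσd) (σ-inj (σ-fixed kσd))) (degree≥3 kd)
  ... | false | true  = trans (sym kσd) (trans (cong kept (σ-fixed kd)) kd)

  kept-α⁺ : ∀ {d} → Kept d → Kept (α d)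
  kept-α⁺ {d} = trans (kept-α d)

  kept-φ⁺ : ∀ {d} → Kept d → Kept (φ d)
  kept-φ⁺ {d} = trans (kept-σ (α d)) ∘ kept-α⁺

  tail-φ : ∀ d → tail (φ d) ≡ tail (α d)
  tail-φ d = tail-σ (α d)

  tail-φα : ∀ d → tail (φ (α d)) ≡ tail d
  tail-φα d = trans (tail-φ (α d)) (cong tail (α-involutive d))

  adjacent-φ : ∀ d → Adj (tail d) (tail (φ d))
  adjacent-φ d = subst (Adj (tail d)) (sym (tail-φ d)) (adjacent d)

  -- As the graph is simple, a face walk returning at once to `tail d` uses the same edge backwards,
  -- so the head of `d` would have degree 1.
  no-leaf : ∀ {d} → Kept d → tail (φ (φ d)) ≢ tail d
  no-leaf {d} kd eq = degree≥3 (kept-α⁺ kd) (trans (cong σ φd≡αd) φd≡αd)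
    where
    φd≡αd : φ d ≡ α d
    φd≡αd = simple (tail-φ d)
      (trans (sym (tail-φ (φ d))) (trans eq (cong tail (sym (α-involutive d)))))

  -- The orbit then has exactly three darts: consecutive tails are adjacent, which rules out a fixed
  -- point of `φ`.
  Triangular : Fin N → Set
  Triangular d = iter φ 3 d ≡ d

  closing : ∀ {d} → Triangular d → Adj (tail (φ (φ d))) (tail d)
  closing {d} tri = subst (Adj _) (cong tail tri) (adjacent-φ (φ (φ d)))

  -- Otherwise the triangular face across `d` would also contain the reverse of `φ d`. The rotation
  -- at the head of `d` would then consist of `α d` and `φ d` only.
  no-ear : ∀ {d} → Kept d → Triangular (α d) → tail (φ (φ (α d))) ≢ tail (φ (φ d))
  no-ear {d} kd tri eq = degree≥3 (kept-α⁺ kd)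
    (trans (cong σ (sym (α-involutive (φ d)))) (trans (cong φ (sym meet)) tri))
    where
    meet : φ (φ (α d)) ≡ α (φ d)
    meet = simple (trans eq (tail-φ (φ d)))
      (trans (sym (tail-φ _)) (trans (cong tail tri)
        (trans (sym (tail-φ d)) (cong tail (sym (α-involutive (φ d)))))))

  -- The two triangles share an edge, so they coincide and have the same third vertex, which
  -- `no-ear` forbids.
  triangular-one-side : ∀ {d} → Kept d → Triangular d → ¬ Triangular (α d)
  triangular-one-side {d} kd tri triα
    with triangle-unique disjoint
           (adjacent-φ (α d)) (adjacent-φ (φ (α d))) (closing triα)
           (subst (λ v → Adj v (tail (φ (φ d)))) (tail-φ d) (adjacent-φ (φ d)))
           (closing tri)
           (adjacent d)
  ... | inj₁ eq = adj⇒≢ (closing tri) (trans eq (tail-φα d))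
  ... | inj₂ eq = no-ear kd triα (sym eq)

  -- Both triangles contain the head of `d`, so they coincide. The head of `φ d` is then either
  -- `tail d`, against `no-leaf`, or the third vertex of the triangle, against `no-ear`.
  no-consecutive : ∀ {d} → Kept d → Triangular (α d) → ¬ Triangular (α (φ d))
  no-consecutive {d} kd tri₁ tri₂
    with triangle-unique disjoint
           (adjacent-φ (α d)) (adjacent-φ (φ (α d))) (closing tri₁)
           (symmetric (subst (Adj _) pivot (adjacent-φ e)))
           (symmetric (closing tri₂))
           (symmetric (subst (λ v → Adj v (tail (φ (φ e)))) pivot (adjacent-φ (φ e))))
    where
    e = α (φ d)
    pivot : tail (φ e) ≡ tail (α d)
    pivot = trans (tail-φα (φ d)) (tail-φ d)
  ... | inj₁ eq = no-leaf kd (trans (tail-φ (φ d)) (trans eq (tail-φα d)))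
  ... | inj₂ eq = no-ear kd tri₁ (trans (sym eq) (sym (tail-φ (φ d))))

  quadrangular⇒on4Cycle : ∀ {d} → Kept d → iter φ 4 d ≡ d → On4Cycle (tail d) (tail (α d))
  quadrangular⇒on4Cycle {d} kd quad = subst (On4Cycle (tail d)) (tail-φ d)
    ( tail (φ (φ d)) , tail (φ (φ (φ d)))
    , adjacent-φ (φ d) , adjacent-φ (φ (φ d))
    , subst (Adj _) (cong tail quad) (adjacent-φ (φ (φ (φ d))))
    , no-leaf kd , no-leaf (kept-φ⁺ kd) )

  -- A good dart takes a unit of charge across its edge into its triangular face.
  Good : Fin N → Set
  Good d = Triangular d × ¬ On4Cycle (tail d) (tail (α d))

  abstract
    good? : Unary.Decidable Good
    good? d = (iter φ 3 d ≟ d) ×-dec ¬? (on4Cycle? (tail d) (tail (α d)))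

  -- A detached edge bounds a face with only two darts, hence the value 4.
  charge-value : (kept gives takes : Bool) → ℕ
  charge-value false _     _     = 4
  charge-value true  true  _     = 1
  charge-value true  false true  = 3
  charge-value true  false false = 2

  -- `d` gives exactly when `α d` is good. By `triangular-one-side` no kept dart both gives and
  -- takes.
  charge : Fin N → ℕ
  charge d = charge-value (kept d) (does (good? (α d))) (does (good? d))

  charge-detached : ∀ {d} → kept d ≡ false → charge d ≡ 4
  charge-detached {d} kd rewrite kd = refl

  charge≥1 : ∀ d → 1 ≤ charge d
  charge≥1 d with kept d | does (good? (α d)) | does (good? d)
  ... | false | _     | _     = s≤s z≤n
  ... | true  | true  | _     = s≤s z≤n
  ... | true  | false | true  = s≤s z≤n
  ... | true  | false | false = s≤s z≤n

  charge≥2 : ∀ d → Good (α d) ⊎ 2 ≤ charge d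
  charge≥2 d with kept d | good? (α d) | does (good? d)
  ... | false | _     | _     = inj₂ (s≤s (s≤s z≤n))
  ... | true  | yes g | _     = inj₁ g
  ... | true  | no _  | true  = inj₂ (s≤s (s≤s z≤n))
  ... | true  | no _  | false = inj₂ (s≤s (s≤s z≤n))

  charge-pair : ∀ {d} → Kept d → 3 ≤ charge d + charge (φ d)
  charge-pair {d} kd with charge≥2 d | charge≥2 (φ d)
  ... | inj₂ ≥2 | _       = +-mono-≤ ≥2 (charge≥1 (φ d))
  ... | inj₁ _  | inj₂ ≥2 = +-mono-≤ (charge≥1 d) ≥2
  ... | inj₁ g  | inj₁ g′ = contradiction (proj₁ g′) (no-consecutive kd (proj₁ g))

  -- The boundary of the face is a 4-cycle through the edge of `d`, so `α d` is not good and `d`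
  -- gives nothing.
  charge-quadrangular : ∀ {d} → Kept d → iter φ 4 d ≡ d → 2 ≤ charge d
  charge-quadrangular {d} kd quad with charge≥2 d
  ... | inj₂ ≥2 = ≥2
  ... | inj₁ (_ , ¬on) = contradiction
    (subst (On4Cycle _) (cong tail (sym (α-involutive d)))
      (on4Cycle-sym (quadrangular⇒on4Cycle kd quad))) ¬on

  -- A dart of a triangular face never gives, by `triangular-one-side`, and fails to take only if
  -- its edge lies on a 4-cycle.
  charge-triangular : ∀ {d} → Kept d → Triangular d →
                      3 ≤ charge d ⊎ 2 ≤ charge d × On4Cycle (tail d) (tail (φ d))
  charge-triangular {d} kd tri
    rewrite kd with good? (α d) | good? d | on4Cycle? (tail d) (tail (α d))
  ... | yes g | _     | _      = contradiction (proj₁ g) (triangular-one-side kd tri)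
  ... | no _  | yes _ | _      = inj₁ ≤-refl
  ... | no _  | no _  | yes on = inj₂ (≤-refl , subst (On4Cycle _) (sym (tail-φ d)) on)
  ... | no _  | no ¬g | no ¬on = contradiction (tri , ¬on) ¬g

  -- At most one edge lies on a 4-cycle, so the charges are at least 3, 3 and 2 in some order.
  triangle-charge : ∀ {d} → Kept d → Triangular d →
                    8 ≤ charge d + (charge (φ d) + (charge (φ (φ d)) + 0))
  triangle-charge {d} kd tri
    with charge-triangular kd tri | charge-triangular (kept-φ⁺ kd) (cong φ tri)
       | charge-triangular (kept-φ⁺ (kept-φ⁺ kd)) (cong (φ ∘ φ) tri)
  ... | inj₁ a       | inj₁ b       | inj₁ c       = ≤-trans (n≤1+n 8) (+-mono-≤ a (+-mono-≤ b (+-mono-≤ c z≤n)))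
  ... | inj₂ (a , _) | inj₁ b       | inj₁ c       = +-mono-≤ a (+-mono-≤ b (+-mono-≤ c z≤n))
  ... | inj₁ a       | inj₂ (b , _) | inj₁ c       = +-mono-≤ a (+-mono-≤ b (+-mono-≤ c z≤n))
  ... | inj₁ a       | inj₁ b       | inj₂ (c , _) = +-mono-≤ a (+-mono-≤ b (+-mono-≤ c z≤n))
  ... | inj₂ (_ , p) | inj₂ (_ , q) | _            = ⊥-elim (at-most-one-edge-on-4-cycle disjoint single
    (adjacent-φ d) (adjacent-φ (φ d)) (closing tri) p q)
  ... | inj₁ _       | inj₂ (_ , p) | inj₂ (_ , q) = ⊥-elim (at-most-one-edge-on-4-cycle disjoint single
    (adjacent-φ (φ d)) (closing tri) (adjacent-φ d) p (subst (On4Cycle _) (cong tail tri) q))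
  ... | inj₂ (_ , q) | inj₁ _       | inj₂ (_ , p) = ⊥-elim (at-most-one-edge-on-4-cycle disjoint single
    (closing tri) (adjacent-φ d) (adjacent-φ (φ d)) (subst (On4Cycle _) (cong tail tri) p) q)

  -- The five cyclic pairs count every dart twice, so twice the total is at least 15; integrality
  -- raises 7.5 to 8.
  pentagon-charge : ∀ a b c d e → 3 ≤ a + b → 3 ≤ b + c → 3 ≤ c + d → 3 ≤ d + e → 3 ≤ e + a →
                    8 ≤ a + (b + (c + (d + (e + 0))))
  pentagon-charge a b c d e ab bc cd de ea = *-cancelˡ-< 2 7 _ (begin
    15                                                    ≤⟨ +-mono-≤ ab (+-mono-≤ bc (+-mono-≤ cd (+-mono-≤ de ea))) ⟩
    a + b + (b + c + (c + d + (d + e + (e + a))))         ≡⟨ twice a b c d e ⟩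
    2 * (a + (b + (c + (d + (e + 0)))))                   ∎)
    where
    open ≤-Reasoning
    twice : ∀ a b c d e → a + b + (b + c + (c + d + (d + e + (e + a)))) ≡ 2 * (a + (b + (c + (d + (e + 0)))))
    twice = solve-∀

  hexagon-charge : ∀ a b c d e f → 3 ≤ a + b → 3 ≤ c + d → 3 ≤ e + f →
                   8 ≤ a + (b + (c + (d + (e + (f + 0)))))
  hexagon-charge a b c d e f ab cd ef = begin
    8                                       ≤⟨ n≤1+n 8 ⟩
    9                                       ≤⟨ +-mono-≤ ab (+-mono-≤ cd ef) ⟩
    a + b + (c + d + (e + f))               ≡⟨ regroup a b c d e f ⟩
    a + (b + (c + (d + (e + (f + 0)))))     ∎
    where
    open ≤-Reasoning
    regroup : ∀ a b c d e f → a + b + (c + d + (e + f)) ≡ a + (b + (c + (d + (e + (f + 0)))))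
    regroup = solve-∀

  -- The charge of a face

  module Faces {f} (F : HasClasses (SameOrbit φ) f) where
    open Classes F
    private class = proj₁ F

    -- As long as the walk has not returned to `d`, its darts are distinct by injectivity of `φ`.
    -- Stopping early is allowed, which serves the faces longer than `m`.
    distinct-≤-fibre : ∀ m d → (∀ j → suc j ℕ.< m → iter φ (suc j) d ≢ d) →
      sum {m} (λ i → charge (iter φ (toℕ i) d)) ≤ fibre class charge (class d)
    distinct-≤-fibre m d aperiodic = sum-injection (λ i → iter φ (toℕ i) d)
      (λ i → ≤-reflexive (sym (guard-yes (class (iter φ (toℕ i) d) ≟ class d)
        (sym (related⇒≡ (orbit-iter (toℕ i)))))))
      λ i j _ _ → injective i j
      where
      no-repeat : ∀ {i j : Fin m} → toℕ i ℕ.< toℕ j → iter φ (toℕ i) d ≢ iter φ (toℕ j) d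
      no-repeat {i} {j} i<j eq
        with toℕ j ∸ toℕ i | m<n⇒0<n∸m i<j | m∸n≤m (toℕ j) (toℕ i) | iter-cancel φ-inj i<j eq
      ... | suc k | _ | 1+k≤j | period = aperiodic k (≤-<-trans 1+k≤j (toℕ<n j)) period

      injective : ∀ i j → iter φ (toℕ i) d ≡ iter φ (toℕ j) d → i ≡ j
      injective i j eq with <-cmp (toℕ i) (toℕ j)
      ... | tri< i<j _ _ = contradiction eq (no-repeat i<j)
      ... | tri≈ _ i≡j _ = toℕ-injective i≡j
      ... | tri> _ _ j<i = contradiction (sym eq) (no-repeat j<i)

    kept-face : ∀ {d} → Kept d → 8 ≤ fibre class charge (class d)
    kept-face {d} kd with returns φ-inj d
    ... | k , ret with least (λ j → iter φ (suc j) d ≟ d) k ret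
    -- The case number is one less than the length of the face. Length 1 would be a loop, and length
    -- 2 a face turning back at a leaf.
    ... | 0 , period , _ = ⊥-elim (adj⇒≢′ (adjacent-φ d) (cong tail period))
    ... | 1 , period , _ = ⊥-elim (no-leaf kd (cong tail period))
    ... | 2 , period , before = ≤-trans (triangle-charge kd period)
      (distinct-≤-fibre 3 d λ j p → before j (≤-pred p))
    ... | 3 , period , before = ≤-trans
      (+-mono-≤ (charge-quadrangular kd period)
        (+-mono-≤ (charge-quadrangular kd₁ (cong φ period))
          (+-mono-≤ (charge-quadrangular kd₂ (cong (φ ∘ φ) period))
            (+-mono-≤ (charge-quadrangular kd₃ (cong (φ ∘ φ ∘ φ) period)) z≤n))))
      (distinct-≤-fibre 4 d λ j p → before j (≤-pred p))
      where
      kd₁ = kept-φ⁺ kd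
      kd₂ = kept-φ⁺ kd₁
      kd₃ = kept-φ⁺ kd₂
    ... | 4 , period , before = ≤-trans
      (pentagon-charge (charge d) (charge (iter φ 1 d)) (charge (iter φ 2 d))
        (charge (iter φ 3 d)) (charge (iter φ 4 d))
        (charge-pair kd) (charge-pair kd₁) (charge-pair kd₂) (charge-pair kd₃)
        (subst (λ x → 3 ≤ charge (iter φ 4 d) + charge x) period (charge-pair (kept-φ⁺ kd₃))))
      (distinct-≤-fibre 5 d λ j p → before j (≤-pred p))
      where
      kd₁ = kept-φ⁺ kd
      kd₂ = kept-φ⁺ kd₁
      kd₃ = kept-φ⁺ kd₂
    -- The first six darts form three disjoint consecutive pairs and carry charge 9 already.
    ... | suc (suc (suc (suc (suc m)))) , _ , before = ≤-trans
      (hexagon-charge (charge d) (charge (iter φ 1 d)) (charge (iter φ 2 d))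
        (charge (iter φ 3 d)) (charge (iter φ 4 d)) (charge (iter φ 5 d))
        (charge-pair kd) (charge-pair kd₂) (charge-pair (kept-φ⁺ (kept-φ⁺ kd₂))))
      (distinct-≤-fibre 6 d λ j p → before j (≤-trans (≤-pred p) (m≤m+n 5 m)))
      where
      kd₂ = kept-φ⁺ (kept-φ⁺ kd)

    detached-face : ∀ {d} → kept d ≡ false → 8 ≤ fibre class charge (class d)
    detached-face {d} kd = ≤-trans (≤-reflexive (sym total))
      (distinct-≤-fibre 2 d λ where
        zero    _ eq → adj⇒≢′ (adjacent-φ d) (cong tail eq)
        (suc _) (s≤s (s≤s ())))
      where
      total : charge d + (charge (φ d) + 0) ≡ 8
      total = cong₂ (λ x y → x + (y + 0)) (charge-detached kd)
        (charge-detached (trans (kept-σ (α d)) (trans (kept-α d) kd)))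

    faces-bound : f * 8 ≤ sum charge
    faces-bound = fibres-≥ class λ j → subst (λ i → 8 ≤ fibre class charge i)
      (class-representative j) (every (representative j))
      where
      every : ∀ d → 8 ≤ fibre class charge (class d)
      every d with kept d in kd
      ... | true  = kept-face kd
      ... | false = detached-face kd

  -- Double counting and Euler's inequality

  detached : Fin N → Bool
  detached = not ∘ kept

  -- What one dart takes, its reverse gives, so a kept edge retains 2 + 2; a detached edge has 4 +
  -- 4. The case of two good darts is simply estimated.
  charge-edge : ∀ d → charge d + charge (α d) ≤ 4 * ⟦ kept d ⟧ + 8 * ⟦ detached d ⟧
  charge-edge d rewrite kept-α d | α-involutive d
    with kept d | does (good? (α d)) | does (good? d)
  ... | false | _     | _     = ≤-refl
  ... | true  | true  | true  = s≤s (s≤s z≤n)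
  ... | true  | true  | false = ≤-refl
  ... | true  | false | true  = ≤-refl
  ... | true  | false | false = ≤-refl

  sum-scaled : ∀ a b → sum (λ d → a * ⟦ kept d ⟧ + b * ⟦ detached d ⟧) ≡ a * size kept + b * size detached
  sum-scaled a b = trans (∑-distrib-+ {N} _ _)
    (cong₂ _+_ (sym (*-distribˡ-sum {N} a _)) (sym (*-distribˡ-sum {N} b _)))

  -- Doubling the sum pairs each dart with its reverse without choosing one dart per edge.
  total-charge : sum charge + sum charge ≤ 4 * size kept + 8 * size detached
  total-charge = begin
    sum charge + sum charge             ≤⟨ +-monoʳ-≤ (sum charge) reindex ⟩
    sum charge + sum (charge ∘ α)       ≡⟨ sym (∑-distrib-+ {N} charge (charge ∘ α)) ⟩
    sum (λ d → charge d + charge (α d)) ≤⟨ sum-mono charge-edge ⟩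
    sum (λ d → 4 * ⟦ kept d ⟧ + 8 * ⟦ detached d ⟧) ≡⟨ sum-scaled 4 8 ⟩
    4 * size kept + 8 * size detached   ∎
    where
    open ≤-Reasoning
    reindex : sum charge ≤ sum (charge ∘ α)
    reindex = sum-injection α (λ d → ≤-reflexive (cong charge (sym (α-involutive d))))
      λ _ _ _ _ → α-injective

  edge-orbit : ∀ {x y} → SameOrbit α x y → y ≡ x ⊎ y ≡ α x
  edge-orbit ε = inj₁ refl
  edge-orbit {x} (s ◅ r) with α-step s | edge-orbit r
    where
    α-step : ∀ {x z} → SymClosure (λ x y → α x ≡ y) x z → z ≡ α x
    α-step (fwd eq)   = sym eq
    α-step (bwd refl) = sym (α-involutive _)
  ... | refl | inj₁ eq = inj₂ eq
  ... | refl | inj₂ eq = inj₁ (trans eq (α-involutive x))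

  -- The left side counts all darts, and an orbit of `α` has at most two.
  edges-bound : ∀ {e} → HasClasses (SameOrbit α) e → size kept + size detached ≤ e * 2
  edges-bound {e} E = subst (_≤ e * 2) (∑-distrib-+ {N} _ _) (fibres-≤ class bound)
    where
    open Classes E
    class = proj₁ E

    weight : Fin N → ℕ
    weight d = ⟦ kept d ⟧ + ⟦ detached d ⟧

    weight≤1 : ∀ d → weight d ≤ 1
    weight≤1 d with kept d
    ... | true  = ≤-refl
    ... | false = ≤-refl

    bound : ∀ j → fibre class weight j ≤ 2
    bound j = ≤-trans
      (sum-pair {a = representative j} {α (representative j)} λ d p →
        edge-orbit (≡⇒related (trans (class-representative j)
          (sym (proj₁ (guard-support (class d ≟ j) p))))))
      (+-mono-≤
        (≤-trans (guard-≤ (class (representative j) ≟ j) _) (weight≤1 (representative j)))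
        (≤-trans (guard-≤ (class (α (representative j)) ≟ j) _) (weight≤1 (α (representative j)))))

  component-kept : ∀ {x y} → Component σ x y → kept x ≡ kept y
  component-kept = Eq.gfold isEquivalence kept kept-step
    where
    kept-step : ∀ {x y} → σ x ≡ y ⊎ α x ≡ y → kept x ≡ kept y
    kept-step {x} (inj₁ refl) = sym (kept-σ x)
    kept-step {x} (inj₂ refl) = sym (kept-α x)

  detached-component : ∀ {x y} → kept x ≡ false → Component σ x y → y ≡ x ⊎ y ≡ α x
  detached-component kx ε = inj₁ refl
  detached-component {x} kx (s ◅ r) with neighbour s
    where
    neighbour : ∀ {z} → SymClosure (λ d e → σ d ≡ e ⊎ α d ≡ e) x z → z ≡ x ⊎ z ≡ α x
    neighbour (fwd (inj₁ eq)) = inj₁ (trans (sym eq) (σ-fixed kx))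
    neighbour (fwd (inj₂ eq)) = inj₂ (sym eq)
    neighbour {z} (bwd (inj₁ eq)) = inj₁ (trans (sym (σ-fixed (trans (sym (kept-σ z)) (trans (cong kept eq) kx)))) eq)
    neighbour {z} (bwd (inj₂ eq)) = inj₂ (trans (sym (α-involutive z)) (cong α eq))
  ... | inj₁ refl = detached-component kx r
  ... | inj₂ refl with detached-component (trans (kept-α x) kx) r
  ... | inj₁ eq = inj₂ eq
  ... | inj₂ eq = inj₁ (trans eq (α-involutive x))

  -- A component of detached darts is a single edge, with two darts. The component of `d₀` contains
  -- no detached dart, so an extra weight 2 placed at `d₀` keeps every component within 2.
  components-bound : ∀ {c d₀} → Kept d₀ → HasClasses (Component σ) c → size detached + 2 ≤ c * 2
  components-bound {c} {d₀} kd₀ C = subst (_≤ c * 2)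
    (trans (∑-distrib-+ {N} _ _) (cong (_+_ (size detached)) (sum-point d₀ (λ _ → 2))))
    (fibres-≤ class bound)
    where
    open Classes C
    class = proj₁ C

    weight : Fin N → ℕ
    weight d = ⟦ detached d ⟧ + guard (d₀ ≟ d) 2

    weight-detached : ∀ {d} → kept d ≡ false → weight d ≤ 1
    weight-detached {d} kd with d₀ ≟ d
    ... | yes refl = contradiction (trans (sym kd) kd₀) λ ()
    ... | no _ rewrite kd = ≤-refl

    weight-kept : ∀ {d} → Kept d → weight d ≤ 2
    weight-kept {d} kd rewrite kd = guard-≤ (d₀ ≟ d) 2

    weight-support : ∀ {d} → Kept d → weight d ≢ 0 → d₀ ≡ d
    weight-support {d} kd w≢0 rewrite kd = proj₁ (guard-support (d₀ ≟ d) w≢0)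

    member : ∀ j d → guard (class d ≟ j) (weight d) ≢ 0 → Component σ (representative j) d × weight d ≢ 0
    member j d p with guard-support (class d ≟ j) p
    ... | eq , w≢0 = ≡⇒related (trans (class-representative j) (sym eq)) , w≢0

    bound : ∀ j → fibre class weight j ≤ 2
    bound j with kept (representative j) in kr
    ... | false = ≤-trans
      (sum-pair {a = representative j} {α (representative j)} λ d p →
        detached-component kr (proj₁ (member j d p)))
      (+-mono-≤
        (≤-trans (guard-≤ (class (representative j) ≟ j) _) (weight-detached kr))
        (≤-trans (guard-≤ (class (α (representative j)) ≟ j) _) (weight-detached (trans (kept-α _) kr))))
    ... | true = sum-single below λ d e p q → trans (sym (only d p)) (only e q)
      where
      in-kept : ∀ d → guard (class d ≟ j) (weight d) ≢ 0 → Kept d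
      in-kept d p = trans (sym (component-kept (proj₁ (member j d p)))) kr

      only : ∀ d → guard (class d ≟ j) (weight d) ≢ 0 → d₀ ≡ d
      only d p = weight-support (in-kept d p) (proj₂ (member j d p))

      below : ∀ d → guard (class d ≟ j) (weight d) ≤ 2
      below d with guard (class d ≟ j) (weight d) ℕ.≟ 0
      ... | yes eq = ≤-trans (≤-reflexive eq) z≤n
      ... | no neq = ≤-trans (guard-≤ (class d ≟ j) _) (weight-kept (in-kept d neq))

  module _ (S : Fin n → Bool) (tail∈S : ∀ {d} → Kept d → S (tail d) ≡ true) where

    -- A vertex with a kept representative is matched with its tail in `S`, injectively by
    -- `same-tail`; any other vertex is matched with its detached representative.
    vertices-bound : ∀ {v} → HasClasses (SameOrbit σ) v → v ≤ size S + size detached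
    vertices-bound {v} V = begin
      v                  ≡⟨ sym (trans (sum-const v 1) (*-identityʳ v)) ⟩
      sum {v} (λ _ → 1)  ≤⟨ sum-mono {v} (λ j → split (representative j)) ⟩
      sum (λ j → ⟦ kept (representative j) ⟧ + ⟦ detached (representative j) ⟧)
        ≡⟨ ∑-distrib-+ {v} _ _ ⟩
      sum (λ j → ⟦ kept (representative j) ⟧) + sum (λ j → ⟦ detached (representative j) ⟧)
        ≤⟨ +-mono-≤ kept-vertices detached-vertices ⟩
      size S + size detached ∎
      where
      open ≤-Reasoning
      open Classes V

      split : ∀ d → 1 ≤ ⟦ kept d ⟧ + ⟦ detached d ⟧
      split d with kept d
      ... | true  = ≤-refl
      ... | false = ≤-refl

      inside : ∀ d → ⟦ kept d ⟧ ≤ ⟦ S (tail d) ⟧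
      inside d with kept d in kd
      ... | false = z≤n
      ... | true rewrite tail∈S kd = ≤-refl

      nonzero : ∀ {b} → ⟦ b ⟧ ≢ 0 → b ≡ true
      nonzero {true}  _   = refl
      nonzero {false} 0≢0 = contradiction refl 0≢0

      kept-vertices : sum (λ j → ⟦ kept (representative j) ⟧) ≤ size S
      kept-vertices = sum-injection (tail ∘ representative) (inside ∘ representative)
        λ i j p q eq → representative-injective (same-tail (nonzero p) (nonzero q) eq)

      detached-vertices : sum (λ j → ⟦ detached (representative j) ⟧) ≤ size detached
      detached-vertices = sum-injection representative (λ _ → ≤-refl)
        λ i j _ _ eq → representative-injective (subst (SameOrbit σ _) eq ε)

    sparse : ∀ {d₀} → Kept d₀ → EulerBound σ → size kept ℕ.< 4 * size S
    sparse kd₀ (v , e , f , c , V , E , F , C , euler) =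
      combine (size kept) (size detached) (size S) (sum charge) v e f c euler
        (vertices-bound V) (edges-bound E) (Faces.faces-bound F) total-charge (components-bound kd₀ C)
      where
      combine : ∀ K X S s v e f c → e + 2 * c ≤ v + f → v ≤ S + X → K + X ≤ e * 2 →
                f * 8 ≤ s → s + s ≤ 4 * K + 8 * X → X + 2 ≤ c * 2 → K ℕ.< 4 * S
      -- Four times Euler's inequality gives `2K + 6X + 8 ≤ 4S + K + 6X`. The 8 comes from the
      -- component of `d₀` and yields strictness; the padding by 7 leaves just `suc K` after
      -- cancellation.
      combine K X S s v e f c euler v≤ e≥ f≤ s≤ c≥ = +-cancelʳ-≤ (7 + K + 6 * X) (suc K) (4 * S) (begin
        suc K + (7 + K + 6 * X)             ≡⟨ lhs K X ⟩
        2 * (K + X) + 4 * (X + 2)           ≤⟨ +-mono-≤ (*-monoʳ-≤ 2 e≥) (*-monoʳ-≤ 4 c≥) ⟩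
        2 * (e * 2) + 4 * (c * 2)           ≡⟨ mid e c ⟩
        4 * (e + 2 * c)                     ≤⟨ *-monoʳ-≤ 4 euler ⟩
        4 * (v + f)                         ≡⟨ *-distribˡ-+ 4 v f ⟩
        4 * v + 4 * f                       ≤⟨ +-mono-≤ (*-monoʳ-≤ 4 v≤) 4f≤ ⟩
        4 * (S + X) + (K + 2 * X)           ≡⟨ rhs K X S ⟩
        4 * S + (K + 6 * X)                 ≤⟨ +-monoʳ-≤ (4 * S) (m≤n+m (K + 6 * X) 7) ⟩
        4 * S + (7 + (K + 6 * X))           ∎)
        where
        open ≤-Reasoning
        lhs : ∀ K X → suc K + (7 + K + 6 * X) ≡ 2 * (K + X) + 4 * (X + 2)
        lhs = solve-∀
        mid : ∀ e c → 2 * (e * 2) + 4 * (c * 2) ≡ 4 * (e + 2 * c)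
        mid = solve-∀
        rhs : ∀ K X S → 4 * (S + X) + (K + 2 * X) ≡ 4 * S + (K + 6 * X)
        rhs = solve-∀
        dbl : ∀ f → 4 * (4 * f) ≡ f * 8 + f * 8
        dbl = solve-∀
        quad : ∀ K X → 4 * K + 8 * X ≡ 4 * (K + 2 * X)
        quad = solve-∀
        4f≤ : 4 * f ≤ K + 2 * X
        4f≤ = *-cancelˡ-≤ 4 (begin
          4 * (4 * f)     ≡⟨ dbl f ⟩
          f * 8 + f * 8   ≤⟨ +-mono-≤ f≤ f≤ ⟩
          s + s           ≤⟨ s≤ ⟩
          4 * K + 8 * X   ≡⟨ quad K X ⟩
          4 * (K + 2 * X) ∎)

-- Maps on numbered darts

lookup-injective : {xs : List A} → Unique xs → ∀ i j → List.lookup xs i ≡ List.lookup xs j → i ≡ j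
lookup-injective (x∉ ∷ u) zero    zero    eq = refl
lookup-injective (x∉ ∷ u) zero    (suc j) eq = contradiction eq (All.lookup x∉ (∈-lookup j))
lookup-injective (x∉ ∷ u) (suc i) zero    eq = contradiction (sym eq) (All.lookup x∉ (∈-lookup i))
lookup-injective (x∉ ∷ u) (suc i) (suc j) eq = cong suc (lookup-injective u i j eq)

-- Sums and permutation arguments take place on `Fin N`, so darts are numbered by their positions in
-- the list of ordered adjacent pairs. A dart is determined by its ends because adjacency proofs are
-- unique.
module NumberedDarts {n} (G : Graph n) where
  open Graph G
  open Dart

  pairs : List (Fin n × Fin n)
  pairs = cartesianProduct (allFin n) (allFin n)

  pairs-unique : Unique pairs
  pairs-unique = cartesianProduct⁺ (allFin⁺ n) (allFin⁺ n)

  ∈-pairs : ∀ {p} → p ∈ pairs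
  ∈-pairs {u , v} = ∈-cartesianProduct⁺ (∈-allFin u) (∈-allFin v)

  private
    adjacent? : Unary.Decidable (λ (p : Fin n × Fin n) → Adj (proj₁ p) (proj₂ p))
    adjacent? p = T? (adj (proj₁ p) (proj₂ p))

    listed : List (Fin n × Fin n)
    listed = filter adjacent? pairs

  N : ℕ
  N = List.length listed

  dart-≡ : ∀ {d e : Dart G} → tail d ≡ tail e → head d ≡ head e → d ≡ e
  dart-≡ {dart u v p} {dart .u .v q} refl refl = cong (dart u v) (T-irrelevant p q)

  private
    ∈-listed : ∀ (d : Dart G) → (tail d , head d) ∈ listed
    ∈-listed d = ∈-filter⁺ adjacent? ∈-pairs (tail~head d)

  abstract
    decode : Fin N → Dart G
    decode i = dart (proj₁ (List.lookup listed i)) (proj₂ (List.lookup listed i))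
      (proj₂ (∈-filter⁻ adjacent? {xs = pairs} (∈-lookup i)))

    encode : Dart G → Fin N
    encode d = index (∈-listed d)

    decode-encode : ∀ d → decode (encode d) ≡ d
    decode-encode d = dart-≡ (cong proj₁ (sym (lookup-index (∈-listed d))))
                             (cong proj₂ (sym (lookup-index (∈-listed d))))

    encode-decode : ∀ i → encode (decode i) ≡ i
    encode-decode i = lookup-injective (filter⁺ adjacent? pairs-unique) _ _
      (sym (lookup-index (∈-listed (decode i))))

  encode-injective : Injective _≡_ _≡_ encode
  encode-injective {d} {e} eq = trans (sym (decode-encode d)) (trans (cong decode eq) (decode-encode e))

  decode-injective : Injective _≡_ _≡_ decode
  decode-injective {i} {j} eq = trans (sym (encode-decode i)) (trans (cong encode eq) (encode-decode j))

  transfer : ∀ {Q : Rel (Dart G) 0ℓ} {R : Rel (Fin N) 0ℓ} →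
             (∀ {d e} → Q d e → R (encode d) (encode e)) →
             (∀ {i j} → R i j → Q (decode i) (decode j)) →
             HasClasses (EqClosure Q) k → HasClasses (EqClosure R) k
  transfer {Q = Q} {R} up down (class , surj , iff) =
    class ∘ decode ,
    (λ y → encode (proj₁ (surj y)) , λ where refl → proj₂ (surj y) (decode-encode _)) ,
    λ i j → mk⇔ (Equivalence.to (iff _ _) ∘ Eq.gmap decode down) (lift i j ∘ Equivalence.from (iff _ _))
    where
    lift : ∀ i j → EqClosure Q (decode i) (decode j) → EqClosure R i j
    lift i j r with Eq.gmap {S = R} encode up r
    ... | r′ rewrite encode-decode i | encode-decode j = r′

  α : Fin N → Fin N
  α = encode ∘ reverse G ∘ decode

  origin : Fin N → Fin n
  origin i = tail (decode i)

  decode-α : ∀ i → decode (α i) ≡ reverse G (decode i)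
  decode-α i = decode-encode _

  origin-α : ∀ i → origin (α i) ≡ head (decode i)
  origin-α i = cong tail (decode-α i)

  α-involutive : ∀ i → α (α i) ≡ i
  α-involutive i = trans (cong (encode ∘ reverse G) (decode-α i))
    (trans (cong encode (dart-≡ {reverse G (reverse G (decode i))} refl refl)) (encode-decode i))

  α-adjacent : ∀ i → Adj (origin i) (origin (α i))
  α-adjacent i = subst (Adj (origin i)) (sym (origin-α i)) (tail~head (decode i))

  α-simple : ∀ {i j} → origin i ≡ origin j → origin (α i) ≡ origin (α j) → i ≡ j
  α-simple {i} {j} t h = decode-injective
    (dart-≡ t (trans (sym (origin-α i)) (trans h (origin-α j))))

  module _ (R : RotationSystem G) where
    open RotationSystem R

    σ : Fin N → Fin N
    σ = encode ∘ rotate ∘ decode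

    σ-injective : Injective _≡_ _≡_ σ
    σ-injective eq = decode-injective (Injection.injective (↔⇒↣ rotation) (encode-injective eq))

    private
      up : ∀ (f : Dart G → Dart G) {d e} → f d ≡ e → encode (f (decode (encode d))) ≡ encode e
      up f {d} eq = cong encode (trans (cong f (decode-encode d)) eq)

      down : ∀ (f : Dart G → Dart G) {i j} → encode (f (decode i)) ≡ j → f (decode i) ≡ decode j
      down f eq = trans (sym (decode-encode _)) (cong decode eq)

    origin-orbit : ∀ {i j} → SameOrbit σ i j → origin i ≡ origin j
    origin-orbit = Equivalence.to (orbits-are-vertices _ _) ∘ Eq.gmap decode (down rotate)

    orbit-origin : ∀ {i j} → origin i ≡ origin j → SameOrbit σ i j
    orbit-origin {i} {j} eq
      with Eq.gmap {S = λ x y → σ x ≡ y} encode (up rotate)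
             (Equivalence.from (orbits-are-vertices (decode i) (decode j)) eq)
    ... | r rewrite encode-decode i | encode-decode j = r

    open Detaching α α-involutive using (EulerBound)

    spherical⇒bound : Spherical → EulerBound σ
    spherical⇒bound (v , e , f , c , V , E , F , C , euler) =
      v , e , f , c ,
      transfer (up rotate) (down rotate) V ,
      transfer (up (reverse G)) (down (reverse G)) E ,
      transfer (λ {d} eq → trans (cong (σ ∘ encode ∘ reverse G) (decode-encode d)) (up rotate eq))
        (λ {i} eq → trans (cong rotate (sym (decode-α i))) (down rotate eq)) F ,
      transfer [ inj₁ ∘ up rotate , inj₂ ∘ up (reverse G) ]
        [ inj₁ ∘ down rotate , inj₂ ∘ down (reverse G) ] C ,
      ≤-reflexive (sym euler)

-- Induced subgraphs

module InducedSubgraphs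
  {n} (G : Graph n) (R : RotationSystem G) (spherical : RotationSystem.Spherical R)
  (disjoint : NoTwoIntersectingTriangles G)
  (single : TrianglesAdjacentToAtMostOne4Cycle G)
  where

  open Graph G
  open ShortCycles G using (adj⇒≢)
  open NumberedDarts G
  open Detaching α α-involutive using (Detachment; detach-all)

  induced : (Fin n → Bool) → Fin N → Bool
  induced S d = S (origin d) ∧ S (origin (α d))

  induced⁻ : ∀ S {d} → induced S d ≡ true → S (origin d) ≡ true × S (origin (α d)) ≡ true
  induced⁻ S {d} eq with S (origin d) | S (origin (α d))
  induced⁻ S refl | true | true = refl , refl

  induced-α : ∀ S d → induced S (α d) ≡ induced S d
  induced-α S d = trans (cong (λ e → S (origin (α d)) ∧ S (origin e)) (α-involutive d))
    (∧-comm (S (origin (α d))) (S (origin d)))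

  remove : Fin n → (Fin n → Bool) → Fin n → Bool
  remove v S x = S x ∧ not (does (v ≟ x))

  remove-≢ : ∀ {v x} S → v ≢ x → remove v S x ≡ S x
  remove-≢ {v} {x} S v≢x with v ≟ x
  ... | yes v≡x = contradiction v≡x v≢x
  ... | no _    = ∧-identityʳ (S x)

  size-remove : ∀ {v} S → S v ≡ true → size S ≡ suc (size (remove v S))
  size-remove {v} S v∈S = begin
    size S                                              ≡⟨ sum-cong-≗ pointwise ⟩
    sum (λ x → guard (v ≟ x) 1 + ⟦ remove v S x ⟧)      ≡⟨ ∑-distrib-+ {n} _ _ ⟩
    sum (λ x → guard (v ≟ x) 1) + size (remove v S)     ≡⟨ cong (_+ size (remove v S)) (sum-point v (λ _ → 1)) ⟩
    suc (size (remove v S))                             ∎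
    where
    open ≡-Reasoning
    pointwise : ∀ x → ⟦ S x ⟧ ≡ guard (v ≟ x) 1 + ⟦ remove v S x ⟧
    pointwise x with v ≟ x
    ... | yes refl rewrite v∈S = refl
    ... | no _ = cong ⟦_⟧ (sym (∧-identityʳ (S x)))

  size-positive : ∀ {m} {S : Fin m → Bool} {v} → S v ≡ true → 0 ℕ.< size S
  size-positive {S = S} {v} v∈S = ≤-trans (≤-reflexive (sym (sum-point v (λ _ → 1)))) (sum-mono pointwise)
    where
    pointwise : ∀ x → guard (v ≟ x) 1 ≤ ⟦ S x ⟧
    pointwise x with v ≟ x
    ... | yes refl rewrite v∈S = ≤-refl
    ... | no _ = z≤n

  module _ (S : Fin n → Bool) where

    abstract
      detachment : Detachment (σ R) (λ d → induced S d ≡ false)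
      detachment = detach-all (σ-injective R) (spherical⇒bound R spherical)
        (λ d → induced S d Bool.≟ false)

    open Detachment detachment

    kept⇒ : ∀ {d} → induced S d ≡ true → ¬ induced S d ≡ false
    kept⇒ eq eq′ = contradiction (trans (sym eq) eq′) λ ()

    same-origin : ∀ {d e} → induced S d ≡ true → induced S e ≡ true → origin d ≡ origin e → SameOrbit σ′ d e
    same-origin kd ke eq = keeps (kept⇒ kd) (kept⇒ ke) (orbit-origin R eq)

    -- If σ′ (σ′ d) ≡ d, then d and σ′ d are the only darts leaving their vertex.
    size-small : ∀ {d} → induced S d ≡ true → σ′ (σ′ d) ≡ d →
                 size (induced S) ≤ 4 + size (induced (remove (origin d) S))
    size-small {d} kd period = begin
      size (induced S)                                       ≤⟨ sum-mono pointwise ⟩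
      sum (λ x → near x + ⟦ induced S⁻ x ⟧)                  ≡⟨ ∑-distrib-+ {N} near _ ⟩
      sum near + size (induced S⁻)                           ≡⟨ cong (_+ size (induced S⁻)) near-4 ⟩
      4 + size (induced S⁻)                                  ∎
      where
      open ≤-Reasoning
      v = origin d
      e = σ′ d
      S⁻ = remove v S

      δ : Fin N → Fin N → ℕ
      δ a x = guard (a ≟ x) 1

      -- Only the darts leaving or entering `v` are lost: `d`, `e` and their reverses. If `e ≡ d`
      -- they are counted twice, which an upper bound permits.
      near : Fin N → ℕ
      near x = (δ d x + δ e x) + (δ (α d) x + δ (α e) x)

      near-4 : sum near ≡ 4
      near-4 = trans (∑-distrib-+ {N} _ _) (cong₂ _+_ (pair d e) (pair (α d) (α e)))
        where
        pair : ∀ a b → sum (λ x → δ a x + δ b x) ≡ 2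
        pair a b = trans (∑-distrib-+ {N} _ _) (cong₂ _+_ (sum-point a (λ _ → 1)) (sum-point b (λ _ → 1)))

      iterates : ∀ k → iter σ′ k d ≡ d ⊎ iter σ′ k d ≡ e
      iterates zero = inj₁ refl
      iterates (suc k) with iterates k
      ... | inj₁ eq = inj₂ (cong σ′ eq)
      ... | inj₂ eq = inj₁ (trans (cong σ′ eq) period)

      around : ∀ {x} → induced S x ≡ true → v ≡ origin x → x ≡ d ⊎ x ≡ e
      around kx eq with forward injective (same-origin kd kx eq)
      ... | k , refl = iterates k

      δ-self : ∀ a → δ a a ≡ 1
      δ-self a = guard-yes (a ≟ a) refl

      near-tail : ∀ {x} → x ≡ d ⊎ x ≡ e → 1 ≤ near x
      near-tail {x} x∈ = m≤n⇒m≤n+o (δ (α d) x + δ (α e) x) ([ first , second ]′ x∈)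
        where
        first : x ≡ d → 1 ≤ δ d x + δ e x
        first refl = m≤n⇒m≤n+o (δ e d) (≤-reflexive (sym (δ-self d)))
        second : x ≡ e → 1 ≤ δ d x + δ e x
        second refl = m≤n⇒m≤o+n (δ d e) (≤-reflexive (sym (δ-self e)))

      near-head : ∀ {x} → α x ≡ d ⊎ α x ≡ e → 1 ≤ near x
      near-head {x} αx∈ = m≤n⇒m≤o+n (δ d x + δ e x) ([ first ∘ flip , second ∘ flip ]′ αx∈)
        where
        flip : ∀ {y} → α x ≡ y → x ≡ α y
        flip eq = trans (sym (α-involutive x)) (cong α eq)
        first : x ≡ α d → 1 ≤ δ (α d) x + δ (α e) x
        first refl = m≤n⇒m≤n+o (δ (α e) (α d)) (≤-reflexive (sym (δ-self (α d))))
        second : x ≡ α e → 1 ≤ δ (α d) x + δ (α e) x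
        second refl = m≤n⇒m≤o+n (δ (α d) (α e)) (≤-reflexive (sym (δ-self (α e))))

      pointwise : ∀ x → ⟦ induced S x ⟧ ≤ near x + ⟦ induced S⁻ x ⟧
      pointwise x with induced S x in kx
      ... | false = z≤n
      ... | true = by-cases (v ≟ origin x) (v ≟ origin (α x))
        where
        by-cases : Dec (v ≡ origin x) → Dec (v ≡ origin (α x)) → 1 ≤ near x + ⟦ induced S⁻ x ⟧
        by-cases (yes eq) _        = ≤-trans (near-tail (around kx eq)) (m≤m+n _ _)
        by-cases (no _)   (yes eq) = ≤-trans
          (near-head (around (trans (induced-α S x) kx) eq)) (m≤m+n _ _)
        by-cases (no ≢t)  (no ≢h)  = ≤-trans
          (≤-reflexive (cong ⟦_⟧ (sym (trans (cong₂ _∧_ (remove-≢ S ≢t) (remove-≢ S ≢h)) kx))))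
          (m≤n+m _ (near x))

    sparse-core : (∀ {d} → induced S d ≡ true → σ′ (σ′ d) ≢ d) → 0 ℕ.< size S →
                  size (induced S) ℕ.< 4 * size S
    sparse-core degree≥3 S≢∅ with any? (λ d → induced S d Bool.≟ true)
    ... | yes (d₀ , kd₀) = Discharging.sparse G disjoint single origin α α-involutive α-adjacent α-simple
      (induced S) (induced-α S) σ′ injective
      (λ d → sym (origin-orbit R (refines step)))
      fixed same-origin degree≥3 S (proj₁ ∘ induced⁻ S) kd₀ bound
    -- Without a kept dart there is no component to provide strictness, but then the left side is 0
    -- and `S` is nonempty.
    ... | no none = subst (ℕ._< 4 * size S) (sym (sum-zero empty)) (≤-trans S≢∅ (m≤m+n (size S) _))
      where
      empty : ∀ d → ⟦ induced S d ⟧ ≡ 0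
      empty d with induced S d in kd
      ... | true  = contradiction (d , kd) none
      ... | false = refl

  -- Counting darts counts edges twice. Deleting a vertex of degree at most 2 lowers the left side
  -- by at most 4 and the right side by exactly 4; the neighbour at the other end of `d` keeps the
  -- set nonempty.
  sparse-induced : ∀ m S → size S ≡ m → 0 ℕ.< size S → size (induced S) ℕ.< 4 * size S
  sparse-induced zero    S eq S≢∅ = contradiction eq (>⇒≢ S≢∅)
  sparse-induced (suc m) S eq S≢∅
    with any? (λ d → (induced S d Bool.≟ true)
               ×-dec (Detachment.σ′ (detachment S) (Detachment.σ′ (detachment S) d) ≟ d))
  ... | no none = sparse-core S (λ kd period → none (_ , kd , period)) S≢∅
  ... | yes (d , kd , period) = begin-strict
    size (induced S)                  ≤⟨ size-small S kd period ⟩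
    4 + size (induced S⁻)             <⟨ +-monoʳ-< 4 (sparse-induced m S⁻ (suc-injective (trans (sym smaller) eq)) S⁻≢∅) ⟩
    4 + 4 * size S⁻                   ≡⟨ sym (*-suc 4 (size S⁻)) ⟩
    4 * suc (size S⁻)                 ≡⟨ cong (4 *_) (sym smaller) ⟩
    4 * size S                        ∎
    where
    open ≤-Reasoning
    S⁻ = remove (origin d) S

    smaller : size S ≡ suc (size S⁻)
    smaller = size-remove S (proj₁ (induced⁻ S kd))

    S⁻≢∅ : 0 ℕ.< size S⁻
    S⁻≢∅ = size-positive {S = S⁻} {origin (α d)}
      (trans (remove-≢ S (adj⇒≢ (α-adjacent d))) (proj₂ (induced⁻ S kd)))

-- The maximum average degree

∣∣≡size : ∀ {m} (p : Subset m) → ∣ p ∣ ≡ size (Vec.lookup p)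
∣∣≡size Vec.[] = refl
∣∣≡size (true  Vec.∷ p) = cong suc (∣∣≡size p)
∣∣≡size (false Vec.∷ p) = ∣∣≡size p

module Subgraphs {n} (G : Graph n) where
  open Graph G
  open NumberedDarts G

  private
    edge? : Unary.Decidable (λ (p : Fin n × Fin n) → proj₁ p Fin.< proj₂ p × Adj (proj₁ p) (proj₂ p))
    edge? (u , v) = (u Fin.<? v) ×-dec T? (adj u v)

  edge-spec : ∀ i → proj₁ (List.lookup edges i) Fin.< proj₂ (List.lookup edges i)
                  × Adj (proj₁ (List.lookup edges i)) (proj₂ (List.lookup edges i))
  edge-spec i = proj₂ (∈-filter⁻ edge? {xs = pairs} (∈-lookup i))

  edges-unique : Unique edges
  edges-unique = filter⁺ edge? pairs-unique

  edge-dart : Fin (List.length edges) → Fin N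
  edge-dart i = encode (dart _ _ (proj₂ (edge-spec i)))

  origin-edge : ∀ i → origin (edge-dart i) ≡ proj₁ (List.lookup edges i)
  origin-edge i = cong Dart.tail (decode-encode _)

  target-edge : ∀ i → origin (α (edge-dart i)) ≡ proj₂ (List.lookup edges i)
  target-edge i = trans (origin-α _) (cong Dart.head (decode-encode _))

  target-reverse : ∀ i → origin (α (α (edge-dart i))) ≡ proj₁ (List.lookup edges i)
  target-reverse i = trans (cong origin (α-involutive (edge-dart i))) (origin-edge i)

  edge-dart-injective : ∀ {i j} → edge-dart i ≡ edge-dart j → i ≡ j
  edge-dart-injective {i} {j} eq = lookup-injective edges-unique i j (cong₂ _,_
    (trans (sym (origin-edge i)) (trans (cong origin eq) (origin-edge j)))
    (trans (sym (target-edge i)) (trans (cong (origin ∘ α) eq) (target-edge j))))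

  module _ {S : Fin n → Bool} {F : Fin (List.length edges) → Bool}
           (ends : ∀ i → F i ≡ true → S (proj₁ (List.lookup edges i)) ≡ true
                                    × S (proj₂ (List.lookup edges i)) ≡ true) where

    private
      kept : Fin N → Bool
      kept d = S (origin d) ∧ S (origin (α d))

      ascending : Fin N → Bool
      ascending d = does (origin d Fin.<? origin (α d))

      kept-edge : ∀ i → F i ≡ true → kept (edge-dart i) ≡ true
      kept-edge i i∈F = let u∈S , v∈S = ends i i∈F in cong₂ _∧_
        (trans (cong S (origin-edge i)) u∈S) (trans (cong S (target-edge i)) v∈S)

      kept-reverse : ∀ i → F i ≡ true → kept (α (edge-dart i)) ≡ true
      kept-reverse i i∈F = let u∈S , v∈S = ends i i∈F in cong₂ _∧_
        (trans (cong S (target-edge i)) v∈S) (trans (cong S (target-reverse i)) u∈S)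

      ascending-edge : ∀ i → ascending (edge-dart i) ≡ true
      ascending-edge i = dec-true (_ Fin.<? _)
        (subst₂ Fin._<_ (sym (origin-edge i)) (sym (target-edge i)) (proj₁ (edge-spec i)))

      descending-reverse : ∀ i → ascending (α (edge-dart i)) ≡ false
      descending-reverse i = dec-false (_ Fin.<? _) λ v<u →
        <-asym (proj₁ (edge-spec i)) (subst₂ Fin._<_ (target-edge i) (target-reverse i) v<u)

      count-ascending : size F ≤ size (λ d → kept d ∧ ascending d)
      count-ascending = sum-injection edge-dart included λ _ _ _ _ → edge-dart-injective
        where
        included : ∀ i → ⟦ F i ⟧ ≤ ⟦ kept (edge-dart i) ∧ ascending (edge-dart i) ⟧
        included i with F i in i∈F
        ... | false = z≤n
        ... | true = ≤-reflexive (sym (cong ⟦_⟧ (cong₂ _∧_ (kept-edge i i∈F) (ascending-edge i))))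

      count-descending : size F ≤ size (λ d → kept d ∧ not (ascending d))
      count-descending = sum-injection (α ∘ edge-dart) included
        λ _ _ _ _ eq → edge-dart-injective (Detaching.α-injective α α-involutive eq)
        where
        included : ∀ i → ⟦ F i ⟧ ≤ ⟦ kept (α (edge-dart i)) ∧ not (ascending (α (edge-dart i))) ⟧
        included i with F i in i∈F
        ... | false = z≤n
        ... | true = ≤-reflexive (sym (cong ⟦_⟧ (cong₂ _∧_ (kept-reverse i i∈F) (cong not (descending-reverse i)))))

    -- Each listed edge has its smaller endpoint first, so it yields one ascending dart and,
    -- reversed, one descending dart; the two families are disjoint.
    twice-edges-≤ : 2 * size F ≤ size kept
    twice-edges-≤ = begin
      2 * size F        ≡⟨ cong (_+_ (size F)) (+-identityʳ (size F)) ⟩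
      size F + size F   ≤⟨ +-mono-≤ count-ascending count-descending ⟩
      size (λ d → kept d ∧ ascending d) + size (λ d → kept d ∧ not (ascending d))
                        ≡⟨ sym (∑-distrib-+ {N} _ _) ⟩
      sum (λ d → ⟦ kept d ∧ ascending d ⟧ + ⟦ kept d ∧ not (ascending d) ⟧)
                        ≡⟨ sum-cong-≗ (λ d → split (kept d) (ascending d)) ⟩
      size kept         ∎
      where
      open ≤-Reasoning
      split : ∀ a b → ⟦ a ∧ b ⟧ + ⟦ a ∧ not b ⟧ ≡ ⟦ a ⟧
      split true  true  = refl
      split true  false = refl
      split false _     = refl

-- The normalised fraction is compared through its unnormalised form, where the inequality is
-- cross-multiplication. For `v = 0` the junk value 0 is below 4.
averageDegree<4 : ∀ v e → (0 ℕ.< v → 2 * e ℕ.< 4 * v) → averageDegree v e < + 4 / 1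
averageDegree<4 zero    e _ = ℚ.*<* (+<+ (s≤s z≤n))
averageDegree<4 (suc v) e bound = ℚₚ.toℚᵘ-cancel-<
  (ℚᵘₚ.<-respˡ-≃ (ℚᵘₚ.≃-sym (ℚₚ.toℚᵘ-fromℚᵘ (mkℚᵘ (+ (2 * e)) v)))
    (*<* (subst₂ ℤ._<_ (sym (ℤₚ.*-identityʳ _)) (ℤₚ.pos-* 4 (suc v)) (+<+ (bound (s≤s z≤n))))))

theorem2 : (n : ℕ) (G : Graph n) → Planar G → NoTwoIntersectingTriangles G → TrianglesAdjacentToAtMostOne4Cycle G → mad G < + 4 / 1
theorem2 n G (R , spherical) disjoint single = strict (max<v⁺
  -- This is 0 < 4 for the default value of `max`.
  (nonstrict (averageDegree<4 0 0 λ ()))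
  (map⁺ (All.map (nonstrict ∘ below)
    (all-filter (isSubgraph? G) (cartesianProduct (subsets n) (subsets (List.length edges)))))))
  where
  open Graph G
  open Extrema (DecTotalOrder.totalOrder ℚₚ.≤-decTotalOrder) using (max<v⁺)

  -- `max<v⁺` speaks of the strict order derived from the total order, namely `≤` together with `≢`.
  nonstrict : ∀ {p q} → p < q → p ℚ.≤ q × p ≢ q
  nonstrict p<q = ℚₚ.<⇒≤ p<q , ℚₚ.<⇒≢ p<q

  strict : ∀ {p q} → p ℚ.≤ q × p ≢ q → p < q
  strict (p≤q , p≢q) = ℚₚ.≰⇒> (p≢q ∘ ℚₚ.≤-antisym p≤q)

  below : ∀ {S F} → IsSubgraph G (S , F) → averageDegree (∣ S ∣) (∣ F ∣) < + 4 / 1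
  below {S} {F} sub rewrite ∣∣≡size S | ∣∣≡size F = averageDegree<4 _ _ λ S≢∅ →
    ≤-<-trans
      (Subgraphs.twice-edges-≤ G {Vec.lookup S} {Vec.lookup F} λ i i∈F →
        let u∈S , v∈S = sub i (lookup⇒[]= i F i∈F) in []=⇒lookup u∈S , []=⇒lookup v∈S)
      (InducedSubgraphs.sparse-induced G R spherical disjoint single _ (Vec.lookup S) refl S≢∅)
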